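{- There is a deterministic distributed algorithm in the $\mathsf{LOCAL}$ model that, for every $0<\epsilon<1$ and every $n$-node graph with maximum degree $\Delta$, computes a proper edge coloring with at most $(2+\epsilon)\Delta$ colors in $O(\log^{11} n/\epsilon^{3})$ rounds.
   Context: $\mathsf{LOCAL}$ model: the network is an $n$-node simple undirected graph $G$ with one processor on each vertex; computation proceeds in synchronous rounds, and in each round each processor can send one message (of unbounded size) to each of its neighbors; local computation is free. Initially each node knows only its neighbors; nodes have distinct $O(\log n)$-bit identifiers and know the global parameters (such as $n$, $\Delta$, $\epsilon$). A bound of $O(f)$ rounds means $O(\max\{1,f\})$. A proper edge coloring assigns colors to the edges so that edges sharing an endpoint get different colors. -}

module Defs where

open import Data.Bool using (Bool; true; false; T)
import Data.Bool.Properties as Bool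
open import Data.Fin using (Fin)
open import Data.Fin.Properties using (any?)
open import Data.Fin.Subset using (Subset; ∣_∣)
open import Data.Integer using (+_)
open import Data.List using (map; allFin)
open import Data.List.Extrema.Nat using (max)
open import Data.Maybe as Maybe using (Maybe; is-just)
open import Data.Nat using (ℕ; zero; suc)
import Data.Nat as ℕ
open import Data.Nat.Logarithm using (⌊log₂_⌋; ⌈log₂_⌉)
open import Data.Product using (∃; _×_; proj₁)
open import Data.Rational using (ℚ; 0ℚ; 1ℚ; _/_; _+_; _*_; _⊔_; _≤_; _<_)
open import Data.Sum using (_⊎_)
open import Data.Vec using (Vec; tabulate)
open import Data.Vec.Properties using (≡-dec)
open import Function using (_⇔_; _∘_)
open import Relation.Binary.Definitions using (DecidableEquality)
open import Relation.Binary.PropositionalEquality using (_≡_; _≢_)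
open import Relation.Nullary using (¬_; Dec; _×-dec_)
open import Relation.Nullary.Decidable using (dec⇒maybe)

-- Dedekind reals: Lower q means q < x and Upper q means x < q.

record ℝ : Set₁ where
  field
    Lower Upper     : ℚ → Set
    lower-inhabited : ∃ Lower
    upper-inhabited : ∃ Upper
    lower-rounded   : ∀ q → Lower q ⇔ (∃ λ r → q < r × Lower r)
    upper-rounded   : ∀ r → Upper r ⇔ (∃ λ q → q < r × Upper q)
    disjoint        : ∀ q → ¬ (Lower q × Upper q)
    located         : ∀ q r → q < r → Lower q ⊎ Upper r

infix 4 _<ᴿ_ _ᴿ<_

_<ᴿ_ : ℚ → ℝ → Set
q <ᴿ x = ℝ.Lower x q

_ᴿ<_ : ℝ → ℚ → Set
x ᴿ< q = ℝ.Upper x q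

fromℕ : ℕ → ℚ
fromℕ k = + k / 1

-- k ≤ (2 + ε) Δ.  The right-hand side is continuous and nondecreasing in ε,
-- so it is the infimum of its values at the rationals q > ε.

AtMost[2+_]*_ : ℝ → ℕ → ℕ → Set
(AtMost[2+ ε ]* Δ) k =
  ∀ q → ε ᴿ< q → fromℕ k ≤ (fromℕ 2 + q) * fromℕ Δ

-- t ≤ C · max {1, log¹¹ n / ε³} for ε > 0.  The right-hand side is continuous
-- and nonincreasing in ε, so it is the infimum of its values at the rationals
-- 0 < q < ε; each of these inequalities is multiplied through by q³.  As
-- ⌊log₂ n⌋ ≤ log₂ n, the bound with the real logarithm follows.

RoundBound : ℕ → ℝ → ℕ → ℕ → Set
RoundBound n ε C t =
  ∀ q → 0ℚ < q → q <ᴿ ε →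
  fromℕ t * (q * q * q) ≤ fromℕ C * ((q * q * q) ⊔ fromℕ (⌊log₂ n ⌋ ℕ.^ 11))

record Graph (n : ℕ) : Set where
  field
    adj        : Fin n → Fin n → Bool
    symmetric  : ∀ u v → adj u v ≡ adj v u
    irreflexive : ∀ v → adj v v ≡ false

  Adj : Fin n → Fin n → Set
  Adj u v = T (adj u v)

  neighbourhood : Fin n → Subset n
  neighbourhood v = tabulate (adj v)

  degree : Fin n → ℕ
  degree v = ∣ neighbourhood v ∣

  maxDegree : ℕ
  maxDegree = max 0 (map degree (allFin n))

open Graph using (maxDegree) public

-- The value col u v is the colour assigned to the edge uv by its endpoint u;
-- it is constrained only when u and v are adjacent.

record IsProperEdgeColouring {n} (G : Graph n) (k : ℕ)
                             (col : Fin n → Fin n → ℕ) : Set where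
  open Graph G
  field
    consistent : ∀ u v → Adj u v → col u v ≡ col v u
    palette    : ∀ u v → Adj u v → col u v ℕ.< k
    proper     : ∀ u v w → Adj u v → Adj u w → v ≢ w → col u v ≢ col u w

-- Identifiers of O(log n) bits, with c the constant hidden in the O; the
-- max with 1 leaves the single node of a one-node graph some bits.

idLength : ℕ → ℕ → ℕ
idLength c n = c ℕ.* (1 ℕ.⊔ ⌈log₂ n ⌉)

ID : ℕ → ℕ → Set
ID c n = Vec Bool (idLength c n)

_≟ᴵ_ : ∀ {c n} → DecidableEquality (ID c n)
_≟ᴵ_ = ≡-dec Bool._≟_

-- The code run by every node.  Nodes address their neighbours by identifier:
-- `init own nbr` receives the node's identifier and the set of its neighbours'
-- identifiers, `send s i` is the message for neighbour i, `receive s inbox`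
-- gets `nothing` at identifiers that are not those of neighbours, and
-- `output s i` is the colour of the edge to neighbour i.  In particular, the
-- indexing of the vertices by Fin n is invisible to the nodes.

record NodeProgram (I : Set) : Set₁ where
  field
    State Message : Set
    init    : I → (I → Bool) → State
    send    : State → I → Message
    receive : State → (I → Maybe Message) → State
    output  : State → I → ℕ
    rounds  : ℕ

-- The arguments n, Δ and ε are the global parameters known to all nodes.

LocalAlgorithm : ℕ → Set₁
LocalAlgorithm c = ∀ n (Δ : ℕ) (ε : ℝ) → NodeProgram (ID c n)

module Execution {c n} (P : NodeProgram (ID c n)) (G : Graph n)
                 (ident : Fin n → ID c n) where
  open NodeProgram P
  open Graph G

  neighbour? : ∀ v i → Dec (∃ λ u → Adj v u × ident u ≡ i)
  neighbour? v i =
    any? λ u → Bool.T? (adj v u) ×-dec (_≟ᴵ_ {c} {n} (ident u) i)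

  neighbour : Fin n → ID c n → Maybe (Fin n)
  neighbour v i = Maybe.map proj₁ (dec⇒maybe (neighbour? v i))

  state : ℕ → Fin n → State
  state zero    v = init (ident v) (is-just ∘ neighbour v)
  state (suc t) v = receive (state t v) λ i →
    Maybe.map (λ u → send (state t u) (ident v)) (neighbour v i)

  colouring : Fin n → Fin n → ℕ
  colouring u v = output (state rounds u) (ident v)

open Execution using (colouring) public
open NodeProgram using (rounds) public

{-# OPTIONS --safe #-}

-- No ε is needed: 2Δ colours suffice, and O(log⁷ n) rounds.  Take all bit
-- strings of identifier length b = O(log n) as vertices, absent ones being
-- isolated.  Following Rozhoň and Ghaffari, every vertex starts as its own
-- cluster, labelled by its identifier, and the bits of the labels are treated
-- one after the other.  For each bit, a vertex with bit 1 ("red") that has an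
-- uncoloured edge to a vertex with bit 0 ("blue") repeatedly asks to join the
-- blue cluster.  With vertices weighted by their uncoloured edges, a blue
-- cluster accepts if the applicants enlarge it by a factor of more than
-- 1 + 1/m, where m = 4(b + 1), and otherwise kills them all.  Refusing happens
-- at most once per cluster and bit, so a bit kills at most 1/m of the weight,
-- and accepting happens O(b²) times in a row, so clusters keep a polynomial
-- radius.  In the end uncoloured edges between surviving vertices lie within
-- clusters, and edges of different clusters do not meet, so each cluster
-- colours its own greedily.  This at least halves the number of uncoloured
-- edges, and O(b) repetitions colour everything.  As all decisions depend only
-- on a ball of radius O(b⁷), it suffices to flood the graph to that distance
-- and let every node replay the computation.

module Submission where

open import Defs
open import Data.Bool using (Bool; true; false; T; not; _∧_; _∨_; if_then_else_)
import Data.Bool.Properties as Bool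
open import Data.Empty using (⊥)
open import Data.Fin using (Fin; zero; suc; toℕ)
import Data.Fin.Properties as Fin
open import Data.Fin.Subset using (∣_∣)
import Data.Integer as ℤ using (+_; +≤+; _*_)
import Data.Integer.Properties as ℤ
open import Data.List as List using (List; []; _∷_; _++_; length)
import Data.List.Extrema.Nat as Extrema
open import Data.List.Membership.Propositional using (_∈_; _∉_)
open import Data.List.Membership.Propositional.Properties
  using (∈-++⁺ˡ; ∈-++⁺ʳ; ∈-map⁺; ∈-allFin; ∈-cartesianProduct⁺)
import Data.List.Properties as List
import Data.List.Relation.Unary.All as All
open import Data.List.Relation.Unary.Any using (here; there; index)
import Data.List.Relation.Unary.Any.Properties as Any
open import Data.Maybe as Maybe using (Maybe; just; nothing; is-just; is-nothing; maybe)
open import Data.Nat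
  using (ℕ; NonZero; zero; suc; _+_; _*_; _^_; _⊔_; _≤_; _<_; _<ᵇ_; z≤n; s≤s; >-nonZero; ⌊_/2⌋; ⌈_/2⌉)
open import Data.Nat.Induction using (<-rec)
open import Data.Nat.Logarithm
open import Data.Nat.Properties as ℕ hiding (_≟_)
import Data.Nat.Tactic.RingSolver as ℕ-Solver
open import Data.Product using (Σ; ∃; _×_; _,_; proj₁; proj₂)
open import Data.Rational using (0ℚ; 1ℚ)
import Data.Rational as ℚ
import Data.Rational.Properties as ℚ
import Data.Rational.Unnormalised as ℚᵘ
import Data.Rational.Unnormalised.Properties as ℚᵘ
open import Data.Sum using (_⊎_; inj₁; inj₂)
open import Data.Vec using (Vec; []; _∷_; lookup; tabulate)
open import Data.Vec.Properties using (≡-dec; tabulate∘lookup; tabulate-cong)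
open import Function using (_∘_; id; case_of_)
open import Function.Bundles using (Equivalence; mk⇔)
open import Function.Definitions using (Injective)
open import Relation.Binary.Definitions using (tri<; tri≈; tri>)
open import Relation.Binary.PropositionalEquality
  using (_≡_; _≢_; refl; sym; trans; cong; cong₂; subst; subst₂; module ≡-Reasoning)
open import Relation.Nullary using (¬?; _×-dec_; _⊎-dec_; Dec; yes; no; does; contradiction)
open import Relation.Nullary.Decidable using (map′; decidable-stable; dec-true; dec-false)
open import Data.List.Membership.DecPropositional ℕ._≟_ using (_∈?_)

-- Bit strings as vertices

variable
  b : ℕ

Key : ℕ → Set
Key = Vec Bool

infix 4 _≟_ _==_

_≟_ : (x y : Key b) → Dec (x ≡ y)
_≟_ = ≡-dec Bool._≟_

_==_ : Key b → Key b → Bool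
x == y = does (x ≟ y)

lookup-ext : (x y : Key b) → (∀ j → lookup x j ≡ lookup y j) → x ≡ y
lookup-ext x y eq = trans (sym (tabulate∘lookup x)) (trans (tabulate-cong eq) (tabulate∘lookup y))

==-refl : (x : Key b) → (x == x) ≡ true
==-refl x with x ≟ x
... | yes _  = refl
... | no x≢x = contradiction refl x≢x

==⇒≡ : {x y : Key b} → (x == y) ≡ true → x ≡ y
==⇒≡ {x = x} {y} eq with x ≟ y
... | yes x≡y = x≡y

≢⇒== : {x y : Key b} → x ≢ y → (x == y) ≡ false
≢⇒== {x = x} {y} x≢y with x ≟ y
... | yes x≡y = contradiction x≡y x≢y
... | no _    = refl

==-sym : (x y : Key b) → (x == y) ≡ (y == x)
==-sym x y with x ≟ y
... | yes refl = sym (==-refl x)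
... | no x≢y   = sym (≢⇒== (x≢y ∘ sym))

bool? : ∀ p → p ≡ true ⊎ p ≡ false
bool? true  = inj₁ refl
bool? false = inj₂ refl

is-nothing⇒¬is-just : {A : Set} (m : Maybe A) → is-nothing m ≡ true → is-just m ≢ true
is-nothing⇒¬is-just nothing _ ()

¬is-just⇒is-nothing : {A : Set} (m : Maybe A) → is-just m ≢ true → is-nothing m ≡ true
¬is-just⇒is-nothing nothing  _ = refl
¬is-just⇒is-nothing (just _) h = contradiction refl h

-- The Iverson bracket of a Boolean times a weight, so that sums over a subset become sums over all
-- keys. At this precedence `p ∧ q ▹ k` is guarded by the whole conjunction.
infixr 5.5 _▹_

_▹_ : Bool → ℕ → ℕ
true  ▹ k = k
false ▹ k = 0

▹≤ : ∀ p k → p ▹ k ≤ k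
▹≤ true  k = ≤-refl
▹≤ false k = z≤n

▹-∧ : ∀ p q k → p ∧ q ▹ k ≡ p ▹ q ▹ k
▹-∧ true  q k = refl
▹-∧ false q k = refl

-- Exhaustive search over all strings of length `b`; its exponential cost is harmless since local
-- computation is free.
∃? : {P : Key b → Set} → (∀ x → Dec (P x)) → Dec (∃ P)
∃? {zero}  P? = map′ ([] ,_) (λ { ([] , p) → p }) (P? [])
∃? {suc b} P? with ∃? (P? ∘ (false ∷_)) | ∃? (P? ∘ (true ∷_))
... | yes (x , p) | _           = yes (false ∷ x , p)
... | no _        | yes (x , p) = yes (true ∷ x , p)
... | no ¬p       | no ¬q       =
  no λ { (false ∷ x , p) → ¬p (x , p) ; (true ∷ x , p) → ¬q (x , p) }

keys : List (Key b)
keys {zero}  = [] ∷ []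
keys {suc b} = List.map (false ∷_) keys ++ List.map (true ∷_) keys

∈-keys : (x : Key b) → x ∈ keys
∈-keys []          = here refl
∈-keys (false ∷ x) = ∈-++⁺ˡ (∈-map⁺ (false ∷_) (∈-keys x))
∈-keys (true ∷ x)  = ∈-++⁺ʳ _ (∈-map⁺ (true ∷_) (∈-keys x))

-- Tabulating a function on keys turns pointwise equality into propositional
-- equality, so whatever is computed from a table depends only on its entries.

Table : ℕ → Set → Set
Table zero    A = A
Table (suc b) A = Table b A × Table b A

tab : {A : Set} → (Key b → A) → Table b A
tab {zero}  f = f []
tab {suc b} f = tab (f ∘ (false ∷_)) , tab (f ∘ (true ∷_))

look : {A : Set} → Table b A → Key b → A
look t       []          = t
look (t , _) (false ∷ x) = look t x
look (_ , t) (true ∷ x)  = look t x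

tab-cong : {A : Set} {f g : Key b → A} → (∀ x → f x ≡ g x) → tab f ≡ tab g
tab-cong {zero}  f≗g = f≗g []
tab-cong {suc b} f≗g = cong₂ _,_ (tab-cong (f≗g ∘ (false ∷_))) (tab-cong (f≗g ∘ (true ∷_)))

look-tab : {A : Set} (f : Key b → A) → ∀ x → look (tab f) x ≡ f x
look-tab f []          = refl
look-tab f (false ∷ x) = look-tab (f ∘ (false ∷_)) x
look-tab f (true ∷ x)  = look-tab (f ∘ (true ∷_)) x

-- Sums over all keys

∑ : (Key b → ℕ) → ℕ
∑ {zero}  f = f []
∑ {suc b} f = ∑ (f ∘ (false ∷_)) + ∑ (f ∘ (true ∷_))

∑-cong : {f g : Key b → ℕ} → (∀ x → f x ≡ g x) → ∑ f ≡ ∑ g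
∑-cong {zero}  f≗g = f≗g []
∑-cong {suc b} f≗g = cong₂ _+_ (∑-cong (f≗g ∘ (false ∷_))) (∑-cong (f≗g ∘ (true ∷_)))

∑-mono : {f g : Key b → ℕ} → (∀ x → f x ≤ g x) → ∑ f ≤ ∑ g
∑-mono {zero}  f≤g = f≤g []
∑-mono {suc b} f≤g = +-mono-≤ (∑-mono (f≤g ∘ (false ∷_))) (∑-mono (f≤g ∘ (true ∷_)))

∑-mono-< : {f g : Key b → ℕ} → (∀ x → f x ≤ g x) → ∀ y → f y < g y → ∑ f < ∑ g
∑-mono-< f≤g []          f<g = f<g
∑-mono-< f≤g (false ∷ y) f<g =
  +-mono-<-≤ (∑-mono-< (f≤g ∘ (false ∷_)) y f<g) (∑-mono (f≤g ∘ (true ∷_)))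
∑-mono-< f≤g (true ∷ y)  f<g =
  +-mono-≤-< (∑-mono (f≤g ∘ (false ∷_))) (∑-mono-< (f≤g ∘ (true ∷_)) y f<g)

+-interchange : ∀ p q r s → (p + q) + (r + s) ≡ (p + r) + (q + s)
+-interchange = ℕ-Solver.solve-∀

∑-+ : (f g : Key b → ℕ) → ∑ (λ x → f x + g x) ≡ ∑ f + ∑ g
∑-+ {zero}  f g = refl
∑-+ {suc b} f g = trans
  (cong₂ _+_ (∑-+ (f ∘ (false ∷_)) (g ∘ (false ∷_))) (∑-+ (f ∘ (true ∷_)) (g ∘ (true ∷_))))
  (+-interchange (∑ (f ∘ (false ∷_))) _ _ _)

∑-* : ∀ k (f : Key b → ℕ) → ∑ (λ x → k * f x) ≡ k * ∑ f
∑-* {zero}  k f = refl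
∑-* {suc b} k f = trans
  (cong₂ _+_ (∑-* k (f ∘ (false ∷_))) (∑-* k (f ∘ (true ∷_))))
  (sym (*-distribˡ-+ k (∑ (f ∘ (false ∷_))) _))

∑-zero : {f : Key b → ℕ} → (∀ x → f x ≡ 0) → ∑ f ≡ 0
∑-zero {zero}  f≗0 = f≗0 []
∑-zero {suc b} f≗0 = cong₂ _+_ (∑-zero (f≗0 ∘ (false ∷_))) (∑-zero (f≗0 ∘ (true ∷_)))

∑-swap : ∀ {a} (f : Key a → Key b → ℕ) → ∑ (λ x → ∑ (f x)) ≡ ∑ (λ y → ∑ (λ x → f x y))
∑-swap {a = zero}  f = refl
∑-swap {a = suc a} f = trans
  (cong₂ _+_ (∑-swap (f ∘ (false ∷_))) (∑-swap (f ∘ (true ∷_))))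
  (sym (∑-+ (λ y → ∑ (λ x → f (false ∷ x) y)) _))

∑-bound : ∀ {k} {f : Key b → ℕ} → (∀ x → f x ≤ k) → ∑ f ≤ 2 ^ b * k
∑-bound {zero}  {k} f≤k = ≤-trans (f≤k []) (≤-reflexive (sym (+-identityʳ k)))
∑-bound {suc b} {k} {f} f≤k = begin
  ∑ f                   ≤⟨ +-mono-≤ (∑-bound (f≤k ∘ (false ∷_))) (∑-bound (f≤k ∘ (true ∷_))) ⟩
  2 ^ b * k + 2 ^ b * k ≡⟨ double (2 ^ b) k ⟩
  2 ^ suc b * k         ∎
  where
  open ≤-Reasoning
  double : ∀ p k → p * k + p * k ≡ (2 * p) * k
  double = ℕ-Solver.solve-∀

term≤∑ : (f : Key b → ℕ) → ∀ x → f x ≤ ∑ f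
term≤∑ f []          = ≤-refl
term≤∑ f (false ∷ x) = ≤-trans (term≤∑ (f ∘ (false ∷_)) x) (m≤m+n _ _)
term≤∑ f (true ∷ x)  = ≤-trans (term≤∑ (f ∘ (true ∷_)) x) (m≤n+m _ _)

∑-point : (f : Key b → ℕ) (x : Key b) → (∀ y → y ≢ x → f y ≡ 0) → ∑ f ≡ f x
∑-point f []          _   = refl
∑-point f (false ∷ x) off = trans
  (cong₂ _+_ (∑-point (f ∘ (false ∷_)) x (λ y y≢x → off (false ∷ y) λ { refl → y≢x refl }))
             (∑-zero (λ y → off (true ∷ y) λ ())))
  (+-identityʳ _)
∑-point f (true ∷ x)  off = cong₂ _+_
  (∑-zero (λ y → off (false ∷ y) λ ()))
  (∑-point (f ∘ (true ∷_)) x (λ y y≢x → off (true ∷ y) λ { refl → y≢x refl }))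

∑-delta : ∀ (x : Key b) k → ∑ (λ a → (x == a) ▹ k) ≡ k
∑-delta x k = trans
  (∑-point (λ a → (x == a) ▹ k) x (λ y y≢x → cong (_▹ k) (≢⇒== (y≢x ∘ sym))))
  (cong (_▹ k) (==-refl x))

∑-▹ : ∀ p (f : Key b → ℕ) → ∑ (λ x → p ▹ f x) ≡ p ▹ ∑ f
∑-▹ true  f = refl
∑-▹ false f = ∑-zero {f = λ x → false ▹ f x} λ _ → refl

-- Double counting: each `v` contributes for exactly one `a`, namely its label.
∑-group : (q : Key b → Bool) (l : Key b → Key b) (w : Key b → ℕ) →
          ∑ (λ a → ∑ (λ v → q v ∧ (l v == a) ▹ w v)) ≡ ∑ (λ v → q v ▹ w v)
∑-group q l w = trans (∑-swap λ a v → q v ∧ (l v == a) ▹ w v) (∑-cong λ v → begin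
  ∑ (λ a → q v ∧ (l v == a) ▹ w v) ≡⟨ ∑-cong (λ a → ▹-∧ (q v) (l v == a) (w v)) ⟩
  ∑ (λ a → q v ▹ (l v == a) ▹ w v) ≡⟨ ∑-▹ (q v) (λ a → (l v == a) ▹ w v) ⟩
  q v ▹ ∑ (λ a → (l v == a) ▹ w v) ≡⟨ cong (q v ▹_) (∑-delta (l v) (w v)) ⟩
  q v ▹ w v                        ∎)
  where open ≡-Reasoning

-- Carries degrees over from vertices to identifiers. Induction on `n`: vertex `zero` accounts for
-- at most one key, which is removed from `q`; the later vertices cover the rest.
∑-image≤ : ∀ {n} (g : Fin n → Key b) (p : Fin n → Bool) (q : Key b → Bool) →
           (∀ j → q j ≡ true → ∃ λ u → p u ≡ true × g u ≡ j) →
           ∑ (λ j → q j ▹ 1) ≤ ∣ tabulate p ∣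
∑-image≤ {n = zero}  g p q cover = ≤-reflexive (∑-zero λ j → none j (q j) refl)
  where
  none : ∀ j r → q j ≡ r → r ▹ 1 ≡ 0
  none j false _ = refl
  none j true qj with () ← proj₁ (cover j qj)
∑-image≤ {n = suc n} g p q cover with p zero in p0
... | false = ∑-image≤ (g ∘ suc) (p ∘ suc) q λ j qj → case cover j qj of λ
  { (zero , p0′ , _) → contradiction (trans (sym p0′) p0) λ ()
  ; (suc u , h) → u , h }
... | true = begin
  ∑ (λ j → q j ▹ 1)                                     ≤⟨ ∑-mono split ⟩
  ∑ (λ j → ((g zero == j) ▹ 1) + (rest j ▹ 1))        ≡⟨ ∑-+ (λ j → (g zero == j) ▹ 1) _ ⟩
  ∑ (λ j → (g zero == j) ▹ 1) + ∑ (λ j → rest j ▹ 1)    ≡⟨ cong (_+ ∑ (λ j → rest j ▹ 1)) (∑-delta (g zero) 1) ⟩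
  suc (∑ (λ j → rest j ▹ 1))                            ≤⟨ s≤s (∑-image≤ (g ∘ suc) (p ∘ suc) rest cover′) ⟩
  suc ∣ tabulate (p ∘ suc) ∣                            ∎
  where
  open ≤-Reasoning
  rest = λ j → q j ∧ not (g zero == j)
  split : ∀ j → q j ▹ 1 ≤ ((g zero == j) ▹ 1) + (rest j ▹ 1)
  split j with q j | g zero == j
  ... | false | _     = z≤n
  ... | true  | true  = s≤s z≤n
  ... | true  | false = s≤s z≤n
  cover′ : ∀ j → rest j ≡ true → ∃ λ u → p (suc u) ≡ true × g (suc u) ≡ j
  cover′ j rj with q j in qj
  ... | true with cover j qj
  ...   | suc u , h = u , h
  ...   | zero , _ , refl with () ← trans (sym rj) (cong not (==-refl (g zero)))

-- Colours in use and fresh colours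

values : (Key b → Maybe ℕ) → List ℕ
values {zero}  f = maybe (_∷ []) [] (f [])
values {suc b} f = values (f ∘ (false ∷_)) ++ values (f ∘ (true ∷_))

length-values : (f : Key b → Maybe ℕ) → length (values f) ≡ ∑ (λ x → is-just (f x) ▹ 1)
length-values {zero}  f with f []
... | just _  = refl
... | nothing = refl
length-values {suc b} f = trans (List.length-++ (values (f ∘ (false ∷_))))
  (cong₂ _+_ (length-values (f ∘ (false ∷_))) (length-values (f ∘ (true ∷_))))

∈-values : (f : Key b → Maybe ℕ) → ∀ x {k} → f x ≡ just k → k ∈ values f
∈-values f []          eq rewrite eq = here refl
∈-values f (false ∷ x) eq = ∈-++⁺ˡ (∈-values (f ∘ (false ∷_)) x eq)
∈-values f (true ∷ x)  eq = ∈-++⁺ʳ _ (∈-values (f ∘ (true ∷_)) x eq)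

-- Pigeonhole: if all of the numbers 0, ..., `length xs` occurred in `xs`, two of them would occupy
-- the same position.
fresh : (xs : List ℕ) → ∃ λ k → k ≤ length xs × k ∉ xs
fresh xs with Fin.any? (λ (k : Fin (suc (length xs))) → ¬? (toℕ k ∈? xs))
... | yes (k , k∉xs) = toℕ k , Fin.toℕ≤pred[n] k , k∉xs
... | no  all∈xs     = contradiction (Fin.toℕ-injective i≡j) (Fin.<⇒≢ i<j)
  where
  in-xs : ∀ (k : Fin (suc (length xs))) → toℕ k ∈ xs
  in-xs k = decidable-stable (toℕ k ∈? xs) λ k∉xs → all∈xs (k , k∉xs)
  collision = Fin.pigeonhole (n<1+n (length xs)) (λ k → index (in-xs k))
  i   = proj₁ collision
  j   = proj₁ (proj₂ collision)
  i<j = proj₁ (proj₂ (proj₂ collision))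
  i≡j : toℕ i ≡ toℕ j
  i≡j = begin
    toℕ i                             ≡⟨ Any.lookup-index (in-xs i) ⟩
    List.lookup xs (index (in-xs i))  ≡⟨ cong (List.lookup xs) (proj₂ (proj₂ (proj₂ collision))) ⟩
    List.lookup xs (index (in-xs j))  ≡⟨ Any.lookup-index (in-xs j) ⟨
    toℕ j                             ∎
    where open ≡-Reasoning

-- (1 + 1/m)ᵏ ≥ 1 + k/m, multiplied through by mᵏ⁺¹.
pow-bernoulli : ∀ m k → m ^ k * (m + k) ≤ m * suc m ^ k
pow-bernoulli m zero    = ≤-reflexive (base m)
  where
  base : ∀ m → 1 * (m + 0) ≡ m * 1
  base = ℕ-Solver.solve-∀
pow-bernoulli m (suc k) = begin
  m ^ suc k * (m + suc k)           ≤⟨ m≤m+n _ (m ^ k * k) ⟩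
  m ^ suc k * (m + suc k) + m ^ k * k ≡⟨ lhs m k (m ^ k) ⟩
  suc m * (m ^ k * (m + k))         ≤⟨ *-monoʳ-≤ (suc m) (pow-bernoulli m k) ⟩
  suc m * (m * suc m ^ k)           ≡⟨ rhs m (suc m ^ k) ⟩
  m * suc m ^ suc k                 ∎
  where
  open ≤-Reasoning
  lhs : ∀ m k p → (m * p) * (m + suc k) + p * k ≡ suc m * (p * (m + k))
  lhs = ℕ-Solver.solve-∀
  rhs : ∀ m p → suc m * (m * p) ≡ m * (suc m * p)
  rhs = ℕ-Solver.solve-∀

-- `pow-bernoulli` at k = m with a factor `m` cancelled, that is (1 + 1/m)ᵐ ≥ 2.
pow-doubles : ∀ m .{{_ : NonZero m}} → 2 * m ^ m ≤ suc m ^ m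
pow-doubles m = *-cancelˡ-≤ m (≤-trans (≤-reflexive (shuffle m (m ^ m))) (pow-bernoulli m m))
  where
  shuffle : ∀ m p → m * (2 * p) ≡ p * (m + m)
  shuffle = ℕ-Solver.solve-∀

-- Growing by the factor 1 + 1/m for `m * k` times in a row multiplies a size by at least 2ᵏ: every
-- block of `m` steps doubles it.
pow-outgrows : ∀ m .{{_ : NonZero m}} k → 2 ^ k * m ^ (m * k) ≤ suc m ^ (m * k)
pow-outgrows m zero    rewrite *-zeroʳ m = ≤-refl
pow-outgrows m (suc k) rewrite *-suc m k | ^-distribˡ-+-* m m (m * k) | ^-distribˡ-+-* (suc m) m (m * k) = begin
  2 * 2 ^ k * (m ^ m * m ^ (m * k))     ≡⟨ shuffle (2 ^ k) (m ^ m) (m ^ (m * k)) ⟩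
  (2 * m ^ m) * (2 ^ k * m ^ (m * k))   ≤⟨ *-mono-≤ (pow-doubles m) (pow-outgrows m k) ⟩
  suc m ^ m * suc m ^ (m * k)           ∎
  where
  open ≤-Reasoning
  shuffle : ∀ p q r → 2 * p * (q * r) ≡ (2 * q) * (p * r)
  shuffle = ℕ-Solver.solve-∀

-- Distance

-- Walks of length at most `d`: `here` may leave steps over, so enlarging `d` does not change the
-- walk.
data Reach (X : Key b → Key b → Bool) : ℕ → Key b → Key b → Set where
  here : ∀ {d v} → Reach X d v v
  step : ∀ {d v u x} → X v u ≡ true → Reach X d u x → Reach X (suc d) v x

reach? : (X : Key b → Key b → Bool) → ∀ d v x → Dec (Reach X d v x)
reach? X zero    v x = map′ (λ { refl → here }) (λ { here → refl }) (v ≟ x)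
reach? X (suc d) v x =
  map′ (λ { (inj₁ refl) → here ; (inj₂ (u , Xvu , r)) → step Xvu r })
       (λ { here → inj₁ refl ; (step Xvu r) → inj₂ (_ , Xvu , r) })
       (v ≟ x ⊎-dec ∃? λ u → X v u Bool.≟ true ×-dec reach? X d u x)

module _ {X : Key b → Key b → Bool} where

  reach-mono : ∀ {d e v x} → d ≤ e → Reach X d v x → Reach X e v x
  reach-mono _         here         = here
  reach-mono (s≤s d≤e) (step Xvu r) = step Xvu (reach-mono d≤e r)

  reach-trans : ∀ {d e v u x} → Reach X d v u → Reach X e u x → Reach X (d + e) v x
  reach-trans {d} {e} here r = reach-mono (m≤n+m e d) r
  reach-trans (step Xvu r) s = step Xvu (reach-trans r s)

  reach-snoc : ∀ {d v u x} → Reach X d v u → X u x ≡ true → Reach X (suc d) v x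
  reach-snoc here         Xux = step Xux here
  reach-snoc (step Xvy r) Xux = step Xvy (reach-snoc r Xux)

  reach-sym : (∀ u v → X u v ≡ X v u) → ∀ {d v x} → Reach X d v x → Reach X d x v
  reach-sym X-sym here         = here
  reach-sym X-sym (step Xvu r) = reach-snoc (reach-sym X-sym r) (trans (X-sym _ _) Xvu)

-- States of the vertices

record Core (b : ℕ) : Set where
  field
    nbr    : Key b → Bool
    colour : Key b → Maybe ℕ

  pending : Key b → Bool
  pending u = nbr u ∧ is-nothing (colour u)

  -- An uncoloured edge counts at both ends, so the weights of all vertices add up to twice the
  -- number of uncoloured edges.
  weight : ℕ
  weight = ∑ λ u → pending u ▹ 1

-- The `core` survives from one iteration to the next and is constant while clusters form; the other
-- fields are scratch space for the clustering, renewed by `reset`.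
record State (b : ℕ) : Set where
  field
    core     : Core b
    alive    : Bool
    label    : Key b
    proposal : Maybe (Key b)

open Core public
open State public

-- One phase of the clustering

targets : Maybe (Key b) → Key b → Bool
targets nothing  a = false
targets (just x) a = x == a

-- `R` stands for the uncoloured edges and `w` for the number of them at a vertex. By `w-pos` any
-- cluster that can be asked for admission has positive weight, which is what growth starts from.
module Clustering {b} (m : ℕ) (R : Key b → Key b → Bool) (R-sym : ∀ u v → R u v ≡ R v u)
                  (w : Key b → ℕ) (w-pos : ∀ v x → R v x ≡ true → 1 ≤ w x) where

  size : (Key b → State b) → Key b → ℕ
  size σ a = ∑ λ v → alive (σ v) ∧ (label (σ v) == a) ▹ w v

  pull : (Key b → Maybe (Key b)) → Key b → ℕ
  pull p a = ∑ λ v → targets (p v) a ▹ w v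

  dead : (Key b → State b) → ℕ
  dead σ = ∑ λ v → not (alive (σ v)) ▹ w v

  AgreeAt : (Key b → State b) → Fin b → Set
  AgreeAt σ j = ∀ v x → R v x ≡ true → alive (σ v) ≡ true → alive (σ x) ≡ true →
                lookup (label (σ v)) j ≡ lookup (label (σ x)) j

  -- Bit i of its label makes a vertex red (true) or blue (false).
  record Step (i : Fin b) (σ σ′ : Key b → State b) : Set where
    field
      target     : Key b → Maybe (Key b)
      keep-alive : ∀ v → target v ≡ nothing → alive (σ′ v) ≡ alive (σ v)
      keep-label : ∀ v → target v ≡ nothing → label (σ′ v) ≡ label (σ v)
      move-alive : ∀ v a → target v ≡ just a → alive (σ′ v) ≡ (size σ a <ᵇ m * pull target a)
      move-label : ∀ v a → target v ≡ just a → label (σ′ v) ≡ a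
      red        : ∀ v a → target v ≡ just a → lookup (label (σ v)) i ≡ true
      red-alive  : ∀ v a → target v ≡ just a → alive (σ v) ≡ true
      blue       : ∀ v a → target v ≡ just a → lookup a i ≡ false
      contact    : ∀ v a → target v ≡ just a →
                   ∃ λ x → R v x ≡ true × alive (σ x) ≡ true × label (σ x) ≡ a
      no-contact : ∀ v → target v ≡ nothing → alive (σ v) ≡ true → lookup (label (σ v)) i ≡ true →
                   ∀ x → R v x ≡ true → alive (σ x) ≡ true → lookup (label (σ x)) i ≡ true

  module StepProperties {i σ σ′} (s : Step i σ σ′) where
    open Step s

    was-alive : ∀ v → alive (σ′ v) ≡ true → alive (σ v) ≡ true
    was-alive v al with target v in eq
    ... | nothing = trans (sym (keep-alive v eq)) al
    ... | just a  = red-alive v a eq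

    -- A vertex that moves copies the label of a living `R`-neighbour, with which it already agreed
    -- at `j`. So bits treated in earlier phases stay settled.
    label-agrees : ∀ j → AgreeAt σ j → ∀ v → lookup (label (σ′ v)) j ≡ lookup (label (σ v)) j
    label-agrees j agree v with target v in eq
    ... | nothing = cong (λ l → lookup l j) (keep-label v eq)
    ... | just a with contact v a eq
    ...   | x , Rvx , alx , refl =
      trans (cong (λ l → lookup l j) (move-label v a eq)) (sym (agree v x Rvx (red-alive v a eq) alx))

    agree-step : ∀ j → AgreeAt σ j → AgreeAt σ′ j
    agree-step j agree v x Rvx alv alx = begin
      lookup (label (σ′ v)) j ≡⟨ label-agrees j agree v ⟩
      lookup (label (σ v)) j  ≡⟨ agree v x Rvx (was-alive v alv) (was-alive x alx) ⟩
      lookup (label (σ x)) j  ≡⟨ label-agrees j agree x ⟨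
      lookup (label (σ′ x)) j ∎
      where open ≡-Reasoning

    -- The test pull / size > 1/m without division.
    accepts : Key b → Bool
    accepts a = size σ a <ᵇ m * pull target a

    module _ {a} (a-blue : lookup a i ≡ false) where

      -- Only red vertices move, so nobody leaves the blue cluster `a`; hence its size never
      -- decreases during the phase.
      not-a : ∀ v c → target v ≡ just c → (label (σ v) == a) ≡ false
      not-a v c eq = ≢⇒== {x = label (σ v)} {a} λ { refl → contradiction (trans (sym (red v c eq)) a-blue) λ () }

      member⁺ : accepts a ≡ true → ∀ v →
                (alive (σ v) ∧ (label (σ v) == a) ▹ w v) + (targets (target v) a ▹ w v)
                ≤ (alive (σ′ v) ∧ (label (σ′ v) == a) ▹ w v)
      member⁺ acc v with target v in eq
      ... | nothing rewrite keep-alive v eq | keep-label v eq = ≤-reflexive (+-identityʳ _)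
      ... | just c rewrite move-alive v c eq | move-label v c eq
                         | not-a v c eq | Bool.∧-zeroʳ (alive (σ v)) with c ≟ a
      ...   | no _ = z≤n
      ...   | yes refl rewrite acc = ≤-refl

      member : ∀ v → (alive (σ v) ∧ (label (σ v) == a) ▹ w v)
                     ≤ (alive (σ′ v) ∧ (label (σ′ v) == a) ▹ w v)
      member v with target v in eq
      ... | nothing rewrite keep-alive v eq | keep-label v eq = ≤-refl
      ... | just c rewrite not-a v c eq | Bool.∧-zeroʳ (alive (σ v)) = z≤n

      size-step : size σ a ≤ size σ′ a
      size-step = ∑-mono member

      size-accept : accepts a ≡ true → size σ a + pull target a ≤ size σ′ a
      size-accept acc = ≤-trans
        (≤-reflexive (sym (∑-+ (λ v → alive (σ v) ∧ (label (σ v) == a) ▹ w v) λ v → targets (target v) a ▹ w v)))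
        (∑-mono (member⁺ acc))

  module _ (alive₀ : Key b → Bool) where

    -- `alive₀` is the living set at the start of the phase, so older victims that carry the label
    -- `a` are not charged again.
    casualties : (Key b → State b) → Key b → ℕ
    casualties σ a = ∑ λ v → (not (alive (σ v)) ∧ alive₀ v) ∧ (label (σ v) == a) ▹ w v

    Quiet : Fin b → (Key b → State b) → Key b → Set
    Quiet i σ a = ∀ v x → R v x ≡ true → alive (σ v) ≡ true → lookup (label (σ v)) i ≡ true →
                  alive (σ x) ≡ true → label (σ x) ≢ a

    -- The state of a cluster that has accepted in each of `s` rounds: `large` is size ≥ (1 + 1/m)ˢ
    -- cleared of denominators.
    record Growing (s : ℕ) (σ : Key b → State b) (a : Key b) : Set where
      field
        unhurt : casualties σ a ≡ 0
        large  : suc m ^ s ≤ m ^ s * size σ a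

    -- Within a phase a blue cluster grows until it first refuses; from then on no
    -- red vertex touches it, so it kills only once.  The weight it killed is
    -- accounted to it because killed vertices carry the label of their killer.
    record Stopped (i : Fin b) (σ : Key b → State b) (a : Key b) : Set where
      field
        quiet : Quiet i σ a
        paid  : m * casualties σ a ≤ size σ a

    module _ {i σ σ′} (st : Step i σ σ′) where
      open Step st
      open StepProperties st

      module _ {a} (a-blue : lookup a i ≡ false) where

        casualties-accept : accepts a ≡ true → casualties σ′ a ≤ casualties σ a
        casualties-accept acc = ∑-mono pointwise
          where
          pointwise : ∀ v → ((not (alive (σ′ v)) ∧ alive₀ v) ∧ (label (σ′ v) == a) ▹ w v)
                            ≤ ((not (alive (σ v)) ∧ alive₀ v) ∧ (label (σ v) == a) ▹ w v)
          pointwise v with target v in eq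
          ... | nothing rewrite keep-alive v eq | keep-label v eq = ≤-refl
          ... | just c rewrite move-alive v c eq | move-label v c eq with c ≟ a
          ...   | no _ rewrite Bool.∧-zeroʳ (not (accepts c) ∧ alive₀ v) = z≤n
          ...   | yes refl rewrite acc = z≤n

        casualties-step : casualties σ′ a ≤ casualties σ a + pull target a
        casualties-step = ≤-trans (∑-mono pointwise)
          (≤-reflexive (∑-+ (λ v → (not (alive (σ v)) ∧ alive₀ v) ∧ (label (σ v) == a) ▹ w v) _))
          where
          pointwise : ∀ v → ((not (alive (σ′ v)) ∧ alive₀ v) ∧ (label (σ′ v) == a) ▹ w v)
                            ≤ ((not (alive (σ v)) ∧ alive₀ v) ∧ (label (σ v) == a) ▹ w v)
                              + (targets (target v) a ▹ w v)
          pointwise v with target v in eq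
          ... | nothing rewrite keep-alive v eq | keep-label v eq = m≤m+n _ _
          ... | just c rewrite move-label v c eq with c ≟ a
          ...   | no _ rewrite Bool.∧-zeroʳ (not (alive (σ′ v)) ∧ alive₀ v) = z≤n
          ...   | yes refl = ≤-trans (▹≤ _ (w v)) (m≤n+m _ _)

        -- Movers end up with a blue label, so a living red `v` did not move. A living `x` labelled
        -- `a` did not move either, because movers to `a` were killed. Both were thus in place
        -- before the step, where `no-contact` would make `a` red.
        refuse-quiet : accepts a ≡ false → Quiet i σ′ a
        refuse-quiet rej v x Rvx alv redv alx lx with target v in eqv | target x in eqx
        ... | just c | _ = contradiction
          (trans (sym (trans (cong (λ l → lookup l i) (move-label v c eqv)) (blue v c eqv))) redv) λ ()
        ... | nothing | just c with trans (sym (move-label x c eqx)) lx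
        ...   | refl = contradiction (trans (sym alx) (trans (move-alive x c eqx) rej)) λ ()
        refuse-quiet rej v x Rvx alv redv alx lx | nothing | nothing = contradiction
          (trans (sym (no-contact v eqv (trans (sym (keep-alive v eqv)) alv)
                        (trans (cong (λ l → lookup l i) (sym (keep-label v eqv))) redv)
                        x Rvx (trans (sym (keep-alive x eqx)) alx)))
                 (trans (cong (λ l → lookup l i) (trans (sym (keep-label x eqx)) lx)) a-blue)) λ ()

        pull-quiet : Quiet i σ a → pull target a ≡ 0
        pull-quiet quiet = ∑-zero pointwise
          where
          pointwise : ∀ v → targets (target v) a ▹ w v ≡ 0
          pointwise v with target v in eq
          ... | nothing = refl
          ... | just c with c ≟ a
          ...   | no _ = refl
          ...   | yes refl with contact v c eq
          ...     | x , Rvx , alx , lx =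
            contradiction lx (quiet v x Rvx (red-alive v c eq) (red v c eq) alx)

        paid-step : m * (casualties σ a + pull target a) ≤ size σ a → m * casualties σ′ a ≤ size σ′ a
        paid-step h = ≤-trans (*-monoʳ-≤ m casualties-step) (≤-trans h (size-step a-blue))

        -- Acceptance adds more than size/m to the size, which is the factor 1 + 1/m. At the first
        -- refusal there are no earlier casualties, so the whole bill is the current pull, at most
        -- size/m.
        grow-or-stop : ∀ {s} → Growing s σ a → Growing (suc s) σ′ a ⊎ Stopped i σ′ a
        grow-or-stop {s} g with accepts a in acc
        ... | true  = inj₁ record
          { unhurt = n≤0⇒n≡0 (≤-trans (casualties-accept acc) (≤-reflexive (Growing.unhurt g)))
          ; large  = begin
              suc m * suc m ^ s                             ≤⟨ *-monoʳ-≤ (suc m) (Growing.large g) ⟩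
              suc m * (m ^ s * size σ a)                    ≡⟨ split m (m ^ s) (size σ a) ⟩
              m ^ s * (m * size σ a + size σ a)             ≤⟨ *-monoʳ-≤ (m ^ s) (+-monoʳ-≤ (m * size σ a) (<⇒≤ overfull)) ⟩
              m ^ s * (m * size σ a + m * pull target a)    ≡⟨ join m (m ^ s) (size σ a) (pull target a) ⟩
              m * m ^ s * (size σ a + pull target a)        ≤⟨ *-monoʳ-≤ (m * m ^ s) (size-accept a-blue acc) ⟩
              m * m ^ s * size σ′ a                         ∎
          }
          where
          open ≤-Reasoning
          overfull : size σ a < m * pull target a
          overfull = <ᵇ⇒< _ _ (subst T (sym acc) _)
          split : ∀ m p z → suc m * (p * z) ≡ p * (m * z + z)
          split = ℕ-Solver.solve-∀
          join : ∀ m p z y → p * (m * z + m * y) ≡ m * p * (z + y)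
          join = ℕ-Solver.solve-∀
        ... | false = inj₂ record
          { quiet = refuse-quiet acc
          ; paid  = paid-step (≤-trans
              (≤-reflexive (cong (λ z → m * (z + pull target a)) (Growing.unhurt g)))
              (≮⇒≥ λ lt → subst T acc (<⇒<ᵇ lt)))
          }

        stay-stopped : Stopped i σ a → Stopped i σ′ a
        stay-stopped stop = record
          { quiet = refuse-quiet rejects
          ; paid  = paid-step (≤-trans
              (≤-reflexive (cong (m *_) (trans (cong (casualties σ a +_) no-pull) (+-identityʳ _))))
              (Stopped.paid stop))
          }
          where
          no-pull = pull-quiet (Stopped.quiet stop)
          -- Without applicants the test asks for size < 0 and fails, so `refuse-quiet` applies once
          -- more.
          rejects : accepts a ≡ false
          rejects rewrite no-pull | *-zeroʳ m = refl

      progress-step : ∀ {s a} → lookup a i ≡ false → Growing s σ a ⊎ Stopped i σ a →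
                      Growing (suc s) σ′ a ⊎ Stopped i σ′ a
      progress-step a-blue (inj₁ g)    = grow-or-stop a-blue g
      progress-step a-blue (inj₂ stop) = inj₂ (stay-stopped a-blue stop)

    record Phase (i : Fin b) (s : ℕ) (σ : Key b → State b) : Set where
      field
        fallen   : ∀ v → alive (σ v) ≡ false → alive₀ v ≡ true → lookup (label (σ v)) i ≡ false
        progress : ∀ a → lookup a i ≡ false → Growing s σ a ⊎ Stopped i σ a

    phase-step : ∀ {i s σ σ′} → Step i σ σ′ → Phase i s σ → Phase i (suc s) σ′
    phase-step {i} {σ = σ} {σ′} st ph = record
      { fallen   = fallen
      ; progress = λ a a-blue → progress-step st a-blue (Phase.progress ph a a-blue)
      }
      where
      open Step st
      fallen : ∀ v → alive (σ′ v) ≡ false → alive₀ v ≡ true → lookup (label (σ′ v)) i ≡ false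
      fallen v al al₀ with target v in eq
      ... | nothing rewrite keep-label v eq = Phase.fallen ph v (trans (sym (keep-alive v eq)) al) al₀
      ... | just c rewrite move-label v c eq = blue v c eq

    size≤total : ∀ σ a → size σ a ≤ ∑ w
    size≤total σ a = ∑-mono λ v → ▹≤ (alive (σ v) ∧ (label (σ v) == a)) (w v)

    module PhaseEnd .{{_ : NonZero m}} {i k σ} (w-small : ∑ w < 2 ^ k) (ph : Phase i (m * k) σ) where

      -- After `m * k` acceptances in a row the cluster would weigh at least 2ᵏ, more than all
      -- vertices together.
      stopped : ∀ a → lookup a i ≡ false → Stopped i σ a
      stopped a a-blue with Phase.progress ph a a-blue
      ... | inj₂ stop = stop
      ... | inj₁ g    = contradiction outgrown (<-irrefl refl)
        where
        open ≤-Reasoning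
        instance m^>0 = m^n≢0 m (m * k)
        outgrown : m ^ (m * k) * size σ a < m ^ (m * k) * size σ a
        outgrown = begin-strict
          m ^ (m * k) * size σ a ≤⟨ *-monoʳ-≤ (m ^ (m * k)) (size≤total σ a) ⟩
          m ^ (m * k) * ∑ w      <⟨ *-monoʳ-< (m ^ (m * k)) w-small ⟩
          m ^ (m * k) * 2 ^ k    ≡⟨ *-comm (m ^ (m * k)) (2 ^ k) ⟩
          2 ^ k * m ^ (m * k)    ≤⟨ pow-outgrows m k ⟩
          suc m ^ (m * k)        ≤⟨ Growing.large g ⟩
          m ^ (m * k) * size σ a ∎

      -- Where the bits differ, one end is red and the other lies in a blue cluster; that cluster
      -- has stopped, so it is quiet.
      separated : AgreeAt σ i
      separated v x Rvx alv alx with lookup (label (σ v)) i in ev | lookup (label (σ x)) i in ex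
      ... | true  | true  = refl
      ... | false | false = refl
      ... | true  | false = contradiction refl (Stopped.quiet (stopped _ ex) v x Rvx alv ev alx)
      ... | false | true  =
        contradiction refl (Stopped.quiet (stopped _ ev) x v (trans (R-sym x v) Rvx) alx ex alv)

      paid : ∀ a → m * casualties σ a ≤ size σ a
      paid a with lookup a i in ea
      ... | false = Stopped.paid (stopped a ea)
      -- Vertices killed in this phase carry the blue label of their killer, so a red label has no
      -- casualties.
      ... | true  = ≤-trans (≤-reflexive (trans (cong (m *_) (∑-zero none)) (*-zeroʳ m))) z≤n
        where
        none : ∀ v → (not (alive (σ v)) ∧ alive₀ v) ∧ (label (σ v) == a) ▹ w v ≡ 0
        none v with alive (σ v) in al | alive₀ v in al₀ | label (σ v) ≟ a
        ... | true  | _     | _        = refl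
        ... | false | false | _        = refl
        ... | false | true  | no _     = refl
        ... | false | true  | yes refl = contradiction (trans (sym ea) (Phase.fallen ph v al al₀)) λ ()

      -- Every vertex killed in this phase is charged to the cluster named by its label. Each
      -- cluster pays at most 1/m of its size, and the sizes of disjoint clusters sum to at most
      -- `∑ w`.
      dead-step : m * dead σ ≤ m * (∑ λ v → not (alive₀ v) ▹ w v) + ∑ w
      dead-step = begin
        m * dead σ                                      ≤⟨ *-monoʳ-≤ m (∑-mono split) ⟩
        m * (∑ λ v → (not (alive₀ v) ▹ w v) + (q v ▹ w v)) ≡⟨ cong (m *_) (∑-+ (λ v → not (alive₀ v) ▹ w v) _) ⟩
        m * (old + (∑ λ v → q v ▹ w v))                 ≡⟨ *-distribˡ-+ m old _ ⟩
        m * old + m * (∑ λ v → q v ▹ w v)               ≡⟨ cong (λ z → m * old + m * z) (∑-group q (λ v → label (σ v)) w) ⟨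
        m * old + m * ∑ (casualties σ)                  ≡⟨ cong (m * old +_) (∑-* m (casualties σ)) ⟨
        m * old + ∑ (λ a → m * casualties σ a)          ≤⟨ +-monoʳ-≤ (m * old) (∑-mono paid) ⟩
        m * old + ∑ (size σ)                            ≡⟨ cong (m * old +_) (∑-group (λ v → alive (σ v)) (λ v → label (σ v)) w) ⟩
        m * old + (∑ λ v → alive (σ v) ▹ w v)           ≤⟨ +-monoʳ-≤ (m * old) (∑-mono λ v → ▹≤ (alive (σ v)) (w v)) ⟩
        m * old + ∑ w                                   ∎
        where
        open ≤-Reasoning
        q   = λ v → not (alive (σ v)) ∧ alive₀ v
        old = ∑ λ v → not (alive₀ v) ▹ w v
        split : ∀ v → not (alive (σ v)) ▹ w v ≤ (not (alive₀ v) ▹ w v) + (q v ▹ w v)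
        split v with alive (σ v) | alive₀ v
        ... | true  | _     = z≤n
        ... | false | true  = ≤-refl
        ... | false | false = m≤m+n _ _

  -- A nonempty weight is at least 1 = (1 + 1/m)⁰, so the cluster starts as growing. A cluster of
  -- weight zero counts as stopped at once: by `w-pos` no living member has an `R`-neighbour.
  phase-start : ∀ i σ → Phase (λ v → alive (σ v)) i 0 σ
  phase-start i σ = record
    { fallen   = λ v dead-v alive-v → contradiction (trans (sym alive-v) dead-v) λ ()
    ; progress = λ a _ → progress a (size σ a) refl
    }
    where
    al₀ = λ v → alive (σ v)
    none : ∀ a → casualties al₀ σ a ≡ 0
    none a = ∑-zero λ v → cong (λ p → p ∧ (label (σ v) == a) ▹ w v) (Bool.∧-inverseˡ (alive (σ v)))
    progress : ∀ a z → size σ a ≡ z → Growing al₀ 0 σ a ⊎ Stopped al₀ i σ a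
    progress a (suc z) eq = inj₁ record
      { unhurt = none a
      ; large  = ≤-trans (s≤s z≤n) (≤-reflexive (sym (trans (+-identityʳ _) eq)))
      }
    progress a zero eq = inj₂ record
      { quiet = λ v x Rvx _ _ alx lx → contradiction
          (≤-trans (w-pos v x Rvx) (≤-trans (≤-reflexive (sym (counted x alx lx)))
            (≤-trans (term≤∑ (λ v → alive (σ v) ∧ (label (σ v) == a) ▹ w v) x) (≤-reflexive eq)))) λ ()
      ; paid  = ≤-trans (≤-reflexive (trans (cong (m *_) (none a)) (*-zeroʳ m))) z≤n
      }
      where
      counted : ∀ x → alive (σ x) ≡ true → label (σ x) ≡ a → alive (σ x) ∧ (label (σ x) == a) ▹ w x ≡ w x
      counted x alx refl rewrite alx | ==-refl (label (σ x)) = refl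

-- Greedy edge colouring

EdgeColouring : ℕ → Set
EdgeColouring b = Key b → Key b → Maybe ℕ

joins : (x y u v : Key b) → Bool
joins x y u v = ((u == x) ∧ (v == y)) ∨ ((u == y) ∧ (v == x))

joins-swap : (x y u v : Key b) → joins x y u v ≡ joins x y v u
joins-swap x y u v = trans (Bool.∨-comm ((u == x) ∧ (v == y)) _)
  (cong₂ _∨_ (Bool.∧-comm (u == y) (v == x)) (Bool.∧-comm (u == x) (v == y)))

joins-self : (x y : Key b) → joins x y x y ≡ true
joins-self x y rewrite ==-refl x | ==-refl y = refl

joins⁻ : (x y u v : Key b) → joins x y u v ≡ true → (u ≡ x × v ≡ y) ⊎ (u ≡ y × v ≡ x)
joins⁻ x y u v eq with u ≟ x | v ≟ y | u ≟ y | v ≟ x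
... | yes u≡x | yes v≡y | _       | _       = inj₁ (u≡x , v≡y)
... | no _    | _       | yes u≡y | yes v≡x = inj₂ (u≡y , v≡x)
... | yes _   | no _    | yes u≡y | yes v≡x = inj₂ (u≡y , v≡x)

paint : (x y : Key b) → ℕ → EdgeColouring b → EdgeColouring b
paint x y c κ u v = if joins x y u v then just c else κ u v

paint⁻ : ∀ (x y : Key b) c κ u v {d} → paint x y c κ u v ≡ just d →
         (d ≡ c × ((u ≡ x × v ≡ y) ⊎ (u ≡ y × v ≡ x))) ⊎ κ u v ≡ just d
paint⁻ x y c κ u v eq with joins x y u v in j
... | false = inj₂ eq
paint⁻ x y c κ u v refl | true = inj₁ (refl , joins⁻ x y u v j)

-- Only the rows of vertices satisfying `inside` are trusted. Edges leaving this set are seen from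
-- their inner end, where their colours are avoided, but they are never painted.
module Greedy {b} (inside : Key b → Bool) (nbr : Key b → Key b → Bool) where

  paintable : EdgeColouring b → Key b → Key b → Bool
  paintable κ x y = (inside x ∧ inside y) ∧ (nbr x y ∧ is-nothing (κ x y))

  unused : (κ : EdgeColouring b) (x y : Key b) →
           ∃ λ c → c ≤ length (values (κ x) ++ values (κ y)) × c ∉ values (κ x) ++ values (κ y)
  unused κ x y = fresh (values (κ x) ++ values (κ y))

  visit : Key b × Key b → EdgeColouring b → EdgeColouring b
  visit (x , y) κ = if paintable κ x y then paint x y (proj₁ (unused κ x y)) κ else κ

  greedy : EdgeColouring b → EdgeColouring b
  greedy κ = List.foldr visit κ (List.cartesianProduct keys keys)

  visit-outside : ∀ p κ u v → inside u ∧ inside v ≡ false → visit p κ u v ≡ κ u v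
  visit-outside (x , y) κ u v out with inside x in ix | inside y in iy | nbr x y ∧ is-nothing (κ x y)
  ... | false | _     | _     = refl
  ... | true  | false | _     = refl
  ... | true  | true  | false = refl
  ... | true  | true  | true with joins x y u v in j
  ...   | false = refl
  ...   | true with joins⁻ x y u v j
  ...     | inj₁ (refl , refl) rewrite ix | iy = contradiction out λ ()
  ...     | inj₂ (refl , refl) rewrite ix | iy = contradiction out λ ()

  greedy-outside : ∀ κ u v → inside u ∧ inside v ≡ false → greedy κ u v ≡ κ u v
  greedy-outside κ u v out = go (List.cartesianProduct keys keys)
    where
    go : ∀ ps → List.foldr visit κ ps u v ≡ κ u v
    go []       = refl
    go (p ∷ ps) = trans (visit-outside p _ u v out) (go ps)

  visit-keeps : ∀ p κ u v → is-just (κ u v) ≡ true → is-just (visit p κ u v) ≡ true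
  visit-keeps (x , y) κ u v eq with paintable κ x y
  ... | false = eq
  ... | true with joins x y u v
  ...   | false = eq
  ...   | true  = refl

  visit-colours : ∀ κ x y → inside x ≡ true → inside y ≡ true → nbr x y ≡ true →
                  is-just (visit (x , y) κ x y) ≡ true
  visit-colours κ x y ix iy nxy rewrite ix | iy | nxy with κ x y in eq
  ... | just _  rewrite eq = refl
  ... | nothing rewrite joins-self x y = refl

  greedy-keeps : ∀ κ u v → is-just (κ u v) ≡ true → is-just (greedy κ u v) ≡ true
  greedy-keeps κ u v eq = go (List.cartesianProduct keys keys)
    where
    go : ∀ ps → is-just (List.foldr visit κ ps u v) ≡ true
    go []       = eq
    go (p ∷ ps) = visit-keeps p _ u v (go ps)

  greedy-complete : ∀ κ x y → inside x ≡ true → inside y ≡ true → nbr x y ≡ true →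
                    is-just (greedy κ x y) ≡ true
  greedy-complete κ x y ix iy nxy =
    go (List.cartesianProduct keys keys) (∈-cartesianProduct⁺ (∈-keys x) (∈-keys y))
    where
    go : ∀ ps → (x , y) ∈ ps → is-just (List.foldr visit κ ps x y) ≡ true
    go (p ∷ ps) (here refl) = visit-colours _ x y ix iy nxy
    go (p ∷ ps) (there q)   = visit-keeps p _ x y (go ps q)

  -- Relative to `inside`: taken with a cluster it is the invariant of the greedy pass, taken with
  -- all keys it is the global invariant between iterations.
  record Valid (Δ : ℕ) (κ : EdgeColouring b) : Set where
    field
      symmetric : ∀ x y → inside x ≡ true → inside y ≡ true → κ x y ≡ κ y x
      proper    : ∀ x u v c → inside x ≡ true → κ x u ≡ just c → κ x v ≡ just c → u ≡ v
      supported : ∀ x u c → inside x ≡ true → κ x u ≡ just c → nbr x u ≡ true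
      small     : ∀ x u c → inside x ≡ true → κ x u ≡ just c → c < Δ + Δ

  module _ {Δ : ℕ} (nbr-sym : ∀ x y → inside x ≡ true → inside y ≡ true → nbr x y ≡ nbr y x)
           (degree : ∀ x → inside x ≡ true → ∑ (λ u → nbr x u ▹ 1) ≤ Δ) where

    -- Coloured entries of the row of `x` are edges, and the edge to `y` is an uncoloured one, so at
    -- most Δ - 1 entries are coloured.
    few-values : ∀ κ → Valid Δ κ → ∀ x y → inside x ≡ true → nbr x y ≡ true → κ x y ≡ nothing →
                 length (values (κ x)) < Δ
    few-values κ val x y ix nxy eq = ≤-trans
      (≤-trans (≤-reflexive (cong suc (length-values (κ x)))) (∑-mono-< below y strict))
      (degree x ix)
      where
      below : ∀ u → is-just (κ x u) ▹ 1 ≤ nbr x u ▹ 1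
      below u with κ x u in e
      ... | nothing = z≤n
      ... | just c rewrite Valid.supported val x u c ix e = ≤-refl
      strict : is-just (κ x y) ▹ 1 < nbr x y ▹ 1
      strict rewrite eq | nxy = s≤s z≤n

    visit-valid : ∀ p κ → Valid Δ κ → Valid Δ (visit p κ)
    visit-valid (x , y) κ val with inside x in ix | inside y in iy | nbr x y in nxy | κ x y in κxy
    ... | false | _     | _     | _       = val
    ... | true  | false | _     | _       = val
    ... | true  | true  | false | _       = val
    ... | true  | true  | true  | just _  = val
    ... | true  | true  | true  | nothing = record
      { symmetric = λ u v iu iv → cong₂ (λ j k → if j then just c else k)
                                        (joins-swap x y u v) (Valid.symmetric val u v iu iv)
      ; proper    = proper
      ; supported = supported
      ; small     = small
      }
      where
      c   = proj₁ (unused κ x y)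
      c≤  = proj₁ (proj₂ (unused κ x y))
      c∉  = proj₂ (proj₂ (unused κ x y))
      nyx = trans (nbr-sym y x iy ix) nxy
      κyx = trans (Valid.symmetric val y x iy ix) κxy

      new : ∀ z p → (z ≡ x × p ≡ y) ⊎ (z ≡ y × p ≡ x) → ∀ q → κ z q ≢ just c
      new z p (inj₁ (refl , _)) q eq = c∉ (∈-++⁺ˡ (∈-values (κ z) q eq))
      new z p (inj₂ (refl , _)) q eq = c∉ (∈-++⁺ʳ (values (κ x)) (∈-values (κ z) q eq))

      proper : ∀ z p q d → inside z ≡ true → paint x y c κ z p ≡ just d → paint x y c κ z q ≡ just d → p ≡ q
      proper z p q d iz ep eq with paint⁻ x y c κ z p ep | paint⁻ x y c κ z q eq
      ... | inj₂ κp           | inj₂ κq           = Valid.proper val z p q d iz κp κq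
      ... | inj₁ (refl , zp)  | inj₂ κq           = contradiction κq (new z p zp q)
      ... | inj₂ κp           | inj₁ (refl , zq)  = contradiction κp (new z q zq p)
      ... | inj₁ (_ , inj₁ (refl , refl)) | inj₁ (_ , inj₁ (_ , refl))    = refl
      ... | inj₁ (_ , inj₁ (refl , refl)) | inj₁ (_ , inj₂ (refl , refl)) = refl
      ... | inj₁ (_ , inj₂ (refl , refl)) | inj₁ (_ , inj₁ (refl , refl)) = refl
      ... | inj₁ (_ , inj₂ (refl , refl)) | inj₁ (_ , inj₂ (_ , refl))    = refl

      supported : ∀ z p d → inside z ≡ true → paint x y c κ z p ≡ just d → nbr z p ≡ true
      supported z p d iz ep with paint⁻ x y c κ z p ep
      ... | inj₂ κp                       = Valid.supported val z p d iz κp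
      ... | inj₁ (_ , inj₁ (refl , refl)) = nxy
      ... | inj₁ (_ , inj₂ (refl , refl)) = nyx

      small : ∀ z p d → inside z ≡ true → paint x y c κ z p ≡ just d → d < Δ + Δ
      small z p d iz ep with paint⁻ x y c κ z p ep
      ... | inj₂ κp         = Valid.small val z p d iz κp
      -- At most Δ - 1 colours are blocked at each end, so the fresh colour is at most 2Δ - 2.
      ... | inj₁ (refl , _) = ≤-<-trans c≤ (≤-<-trans (≤-reflexive (List.length-++ (values (κ x))))
        (+-mono-< (few-values κ val x y ix nxy κxy) (few-values κ val y x iy nyx κyx)))

    greedy-valid : ∀ κ → Valid Δ κ → Valid Δ (greedy κ)
    greedy-valid κ val = go (List.cartesianProduct keys keys)
      where
      go : ∀ ps → Valid Δ (List.foldr visit κ ps)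
      go []       = val
      go (p ∷ ps) = visit-valid p _ (go ps)

-- The algorithm and its locality

private
  variable
    A : Set

-- What one vertex sees of the configuration; `nothing` marks a vertex out of sight.
View : ℕ → Set
View b = Table b (Maybe (State b))

Update : ℕ → Set
Update b = Key b → State b → View b → State b

Adjacency : ℕ → Set
Adjacency b = Key b → Key b → Bool

seen : {P : Set} → Dec P → A → Maybe A
seen p? a = if does p? then just a else nothing

seen-cong : {P Q : Set} (p? : Dec P) (q? : Dec Q) → (P → Q) → (Q → P) →
            {a c : A} → (P → a ≡ c) → seen p? a ≡ seen q? c
seen-cong (yes p) (yes q) f g a≡c = cong just (a≡c p)
seen-cong (yes p) (no ¬q) f g a≡c = contradiction (f p) ¬q
seen-cong (no ¬p) (yes q) f g a≡c = contradiction (g q) ¬p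
seen-cong (no ¬p) (no ¬q) f g a≡c = refl

seen-yes : {P : Set} (p? : Dec P) → P → {a : A} → seen p? a ≡ just a
seen-yes (yes _) p = refl
seen-yes (no ¬p) p = contradiction p ¬p

seen⁻ : {P : Set} (p? : Dec P) {a c : A} → seen p? a ≡ just c → c ≡ a
seen⁻ (yes _) refl = refl

repeat : ℕ → List A → List A
repeat k xs = List.concat (List.replicate k xs)

SameBall : ℕ → Key b → Adjacency b → Adjacency b → Set
SameBall d v X Y = ∀ u → Reach X d v u → ∀ x → X u x ≡ Y u x

same-mono : ∀ {d e v} {X Y : Adjacency b} → d ≤ e → SameBall e v X Y → SameBall d v X Y
same-mono d≤e same u r = same u (reach-mono d≤e r)

same-at : ∀ {d e v u} {X Y : Adjacency b} → Reach X d v u → SameBall (d + e) v X Y → SameBall e u X Y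
same-at r same x s = same x (reach-trans r s)

reach-same : ∀ {d v x} {X Y : Adjacency b} → SameBall d v X Y → Reach X d v x → Reach Y d v x
reach-same same here         = here
reach-same same (step Xvu r) =
  step (trans (sym (same _ here _)) Xvu) (reach-same (λ y s → same y (step Xvu s)) r)

-- `SameBall` measures the ball in its first graph; a walk of the second is translated edge by edge,
-- since the rows met on the way agree.
same-sym : ∀ {d v} {X Y : Adjacency b} → SameBall d v X Y → SameBall d v Y X
same-sym {X = X} {Y} same u r x = sym (same u (back same r) x)
  where
  back : ∀ {d v u} → SameBall d v X Y → Reach Y d v u → Reach X d v u
  back same here         = here
  back same (step Yvu r) with trans (same _ here _) Yvu
  ... | Xvu = step Xvu (back (λ y s → same y (step Xvu s)) r)

-- `margin` is the m of the acceptance test. `doublings` serves twice: the total weight is to stay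
-- below 2 to this power, which bounds the rounds of a phase, and this many halvings then leave no
-- uncoloured edge.
module Algorithm (b radius margin doublings : ℕ) where

  view : Adjacency b → (Key b → State b) → Key b → View b
  view X σ v = tab λ x → seen (reach? X radius v x) (σ x)

  apply : Update b → Adjacency b → (Key b → State b) → Key b → State b
  apply f X σ v = f v (σ v) (view X σ v)

  exec : List (Update b) → Adjacency b → (Key b → State b) → Key b → State b
  exec []       X σ = σ
  exec (f ∷ fs) X σ = exec fs X (apply f X σ)

  exec-++ : (fs gs : List (Update b)) (X : Adjacency b) (σ : Key b → State b) →
            exec (fs ++ gs) X σ ≡ exec gs X (exec fs X σ)
  exec-++ []       gs X σ = refl
  exec-++ (f ∷ fs) gs X σ = exec-++ fs gs X (apply f X σ)

  weigh : (State b → Bool) → View b → ℕ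
  weigh q t = ∑ λ x → maybe (λ s → q s ▹ weight (core s)) 0 (look t x)

  reset : Update b
  reset v s _ = record s { alive = true ; label = v ; proposal = nothing }

  blueContact : Fin b → State b → View b → Key b → Bool
  blueContact i s t x =
    pending (core s) x ∧ maybe (λ s′ → alive s′ ∧ not (lookup (label s′) i)) false (look t x)

  candidate : Fin b → State b → View b → Maybe (Key b)
  candidate i s t with alive s ∧ lookup (label s) i | ∃? (λ x → blueContact i s t x Bool.≟ true)
  ... | true  | yes (x , _) = Maybe.map label (look t x)
  ... | true  | no _        = nothing
  ... | false | _           = nothing

  propose : Fin b → Update b
  propose i v s t = record s { proposal = candidate i s t }

  -- All applicants of `a` will be shown to see every member and every applicant of `a`, so they
  -- compute the same two sums and need no verdict from the cluster.
  join : Key b → State b → View b → State b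
  join a s t = record s
    { alive = weigh (λ s′ → alive s′ ∧ (label s′ == a)) t <ᵇ
              margin * weigh (λ s′ → targets (proposal s′) a) t
    ; label = a
    }

  decide : Update b
  decide v s t = maybe (λ a → join a s t) s (proposal s)

  -- Everything outside the cluster is erased from the view, so that all members obtain the same
  -- table and hence replay the same greedy colouring.
  cluster : Key b → View b → Table b (Maybe (Core b))
  cluster a t = tab λ x →
    maybe (λ s → if alive s ∧ (label s == a) then just (core s) else nothing) nothing (look t x)

  colourCluster : Table b (Maybe (Core b)) → EdgeColouring b
  colourCluster t = Greedy.greedy (λ x → is-just (look t x))
                                  (λ x y → maybe (λ c → nbr c y) false (look t x))
                                  (λ x y → maybe (λ c → colour c y) nothing (look t x))

  paintCluster : Update b
  paintCluster v s t =
    if alive s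
    then record s { core = record (core s) { colour = colourCluster (cluster (label s) t) v } }
    else s

  round : Fin b → List (Update b)
  round i = propose i ∷ decide ∷ []

  phase : Fin b → List (Update b)
  phase i = repeat (margin * doublings) (round i)

  iteration : List (Update b)
  iteration = reset ∷ List.concatMap phase (List.allFin b) ++ paintCluster ∷ []

  program : List (Update b)
  program = repeat doublings iteration

  initial : Adjacency b → Key b → State b
  initial X v = record
    -- Passing the row through a table makes states with pointwise equal rows propositionally equal,
    -- as `result-local` requires.
    { core     = record { nbr = look (tab (X v)) ; colour = λ _ → nothing }
    ; alive    = true
    ; label    = v
    ; proposal = nothing
    }

  horizon : ℕ
  horizon = length program * radius

  -- The default 0 concerns non-edges only: `final-coloured` provides a colour on every edge.
  result : Adjacency b → Key b → Key b → ℕ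
  result X v u = maybe id 0 (colour (core (exec program X (initial X) v)) u)

  apply-local : ∀ (f : Update b) {X Y σ τ v} → SameBall radius v X Y →
                (∀ x → Reach X radius v x → σ x ≡ τ x) → apply f X σ v ≡ apply f Y τ v
  apply-local f {X} {Y} {σ} {τ} {v} same σ≗τ = cong₂ (f v) (σ≗τ v here) (tab-cong λ x →
    seen-cong (reach? X radius v x) (reach? Y radius v x)
              (reach-same same) (reach-same (same-sym same)) (σ≗τ x))

  -- Information travels `radius` per update. The first update has to agree at every vertex that the
  -- remaining ones can look at, and it looks `radius` further itself.
  exec-local : ∀ (fs : List (Update b)) {X Y σ τ v} → SameBall (length fs * radius) v X Y →
               (∀ x → Reach X (length fs * radius) v x → σ x ≡ τ x) → exec fs X σ v ≡ exec fs Y τ v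
  exec-local     []       same σ≗τ = σ≗τ _ here
  exec-local (f ∷ fs) {v = v} same σ≗τ = exec-local fs (same-mono (m≤n+m _ radius) same) λ x r →
    apply-local f (same-at r (same-mono (≤-reflexive (+-comm (length fs * radius) _)) same))
      λ y s → σ≗τ y (reach-mono (≤-reflexive (+-comm (length fs * radius) _)) (reach-trans r s))

  result-local : ∀ {X Y : Adjacency b} {v} → SameBall horizon v X Y → ∀ u → result X v u ≡ result Y v u
  result-local {X} {Y} {v} same u = cong (λ s → maybe id 0 (colour (core s) u))
    (exec-local program same λ x r →
      cong (λ t → record { core = record { nbr = look t ; colour = λ _ → nothing }
                         ; alive = true ; label = x ; proposal = nothing })
           (tab-cong (same x r)))

-- Correctness of the algorithm

-- Each of the `b` phases kills at most 1/`margin` of the weight, so `margin-wide` keeps the loss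
-- below a quarter. 2ᵇ · 2ᵇ counts ordered pairs and bounds the total weight. Clusters gain at most
-- one unit of radius per round, and `radius` spans two final cluster radii.
module Correctness {b} (radius margin doublings : ℕ) .{{_ : NonZero margin}}
                   (margin-wide : 4 * suc b ≤ margin)
                   (doublings-many : 2 ^ b * 2 ^ b < 2 ^ doublings)
                   (radius-wide : 2 * (b * (margin * doublings)) ≤ radius)
                   (X : Adjacency b) (X-sym : ∀ u v → X u v ≡ X v u)
                   (Δ : ℕ) (degree : ∀ v → ∑ (λ u → X v u ▹ 1) ≤ Δ) where

  open Algorithm b radius margin doublings

  private
    Config : Set
    Config = Key b → State b

  steps : ℕ
  steps = margin * doublings

  look-view : ∀ (σ : Config) v x → Reach X radius v x → look (view X σ v) x ≡ just (σ x)
  look-view σ v x r = trans (look-tab _ x) (seen-yes (reach? X radius v x) r)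

  look-view⁻ : ∀ (σ : Config) v x {s} → look (view X σ v) x ≡ just s → s ≡ σ x
  look-view⁻ σ v x eq = seen⁻ (reach? X radius v x) (trans (sym (look-tab _ x)) eq)

  weigh-view : ∀ (q : State b → Bool) (σ : Config) v → (∀ x → q (σ x) ≡ true → Reach X radius v x) →
               weigh q (view X σ v) ≡ ∑ (λ x → q (σ x) ▹ weight (core (σ x)))
  weigh-view q σ v close = ∑-cong entry
    where
    entry : ∀ x → maybe (λ s → q s ▹ weight (core s)) 0 (look (view X σ v) x) ≡ q (σ x) ▹ weight (core (σ x))
    entry x with look (view X σ v) x in eq
    ... | just s rewrite look-view⁻ σ v x eq = refl
    ... | nothing with q (σ x) in qx
    ...   | false = refl
    ...   | true  = contradiction (trans (sym eq) (look-view σ v x (close x qx))) λ ()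

  -- The centre of a cluster is the vertex whose key is the label; it may itself have left. Walks
  -- run through all of `X`, so this bounds a weak radius.
  Near : ℕ → Config → Set
  Near r σ = ∀ v → alive (σ v) ≡ true → Reach X r (label (σ v)) v

  near-label : ∀ {r σ} → Near r σ → ∀ a v → alive (σ v) ∧ (label (σ v) == a) ≡ true → Reach X r a v
  near-label {r} {σ} near a v eq with alive (σ v) in al
  ... | true = subst (λ l → Reach X r l v) (==⇒≡ eq) (near v al)

  total : Config → ℕ
  total σ = ∑ λ v → weight (core (σ v))

  record Good (σ : Config) : Set where
    field
      nbrs  : ∀ v u → nbr (core (σ v)) u ≡ X v u
      valid : Greedy.Valid (λ _ → true) X Δ (λ v u → colour (core (σ v)) u)

  -- Colours, hence weights, are frozen at κ while the clusters form.
  module OneIteration (κ : Key b → Core b) (κ-nbr : ∀ v u → nbr (κ v) u ≡ X v u)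
                      (κ-valid : Greedy.Valid (λ _ → true) X Δ (λ v u → colour (κ v) u)) where

    R : Adjacency b
    R v x = pending (κ v) x

    R⊆X : ∀ v x → R v x ≡ true → X v x ≡ true
    R⊆X v x eq rewrite κ-nbr v x with X v x
    ... | true = refl

    R-sym : ∀ v x → R v x ≡ R x v
    R-sym v x = cong₂ (λ p c → p ∧ is-nothing c)
      (trans (κ-nbr v x) (trans (X-sym v x) (sym (κ-nbr x v))))
      (Greedy.Valid.symmetric κ-valid v x refl refl)

    w : Key b → ℕ
    w v = weight (κ v)

    w-pos : ∀ v x → R v x ≡ true → 1 ≤ w x
    w-pos v x eq = ≤-trans
      (≤-reflexive (cong (_▹ 1) (trans (sym eq) (R-sym v x)))) (term≤∑ (λ u → R x u ▹ 1) v)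

    w-small : ∑ w < 2 ^ doublings
    w-small = ≤-<-trans (≤-trans (∑-bound λ v → ∑-bound λ u → ▹≤ (R v u) 1)
      (≤-reflexive (cong (2 ^ b *_) (*-identityʳ (2 ^ b))))) doublings-many

    open Clustering margin R R-sym w w-pos

    record Frame (r : ℕ) (σ : Config) : Set where
      field
        cores : ∀ v → core (σ v) ≡ κ v
        near  : Near r σ

    near-step : ∀ {i r σ σ′} → Step i σ σ′ → Near r σ → Near (suc r) σ′
    near-step {r = r} {σ} {σ′} st near v al with Step.target st v in eq
    ... | nothing = subst (λ l → Reach X (suc r) l v) (sym (Step.keep-label st v eq))
      (reach-mono (n≤1+n r) (near v (trans (sym (Step.keep-alive st v eq)) al)))
    ... | just a with Step.contact st v a eq
    ...   | x , Rvx , alx , refl = subst (λ l → Reach X (suc r) l v) (sym (Step.move-label st v a eq))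
      (reach-snoc (near x alx) (trans (X-sym x v) (R⊆X v x Rvx)))

    module Round (i : Fin b) (r : ℕ) (σ : Config) (frame : Frame r σ) (wide : 2 * suc r ≤ radius) where
      open Frame frame

      σ₁ : Config
      σ₁ = apply (propose i) X σ

      target : Key b → Maybe (Key b)
      target v = proposal (σ₁ v)

      adjacent-seen : ∀ v x → R v x ≡ true → look (view X σ v) x ≡ just (σ x)
      adjacent-seen v x Rvx = look-view σ v x
        (reach-mono (≤-trans (s≤s z≤n) wide) (step (R⊆X v x Rvx) here))

      candidate-just : ∀ v a → target v ≡ just a →
        alive (σ v) ≡ true × lookup (label (σ v)) i ≡ true ×
        ∃ λ x → R v x ≡ true × alive (σ x) ≡ true × label (σ x) ≡ a × lookup a i ≡ false
      candidate-just v a eq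
        with alive (σ v) | lookup (label (σ v)) i
           | ∃? (λ x → blueContact i (σ v) (view X σ v) x Bool.≟ true)
      ... | true | true | yes (x , hit) with look (view X σ v) x in seen-x
      ...   | nothing = contradiction eq λ ()
      ...   | just s with look-view⁻ σ v x seen-x
      ...     | refl with pending (core (σ v)) x in Rvx | alive (σ x) in alx | lookup (label (σ x)) i in bit
      candidate-just v a refl | true | true | yes (x , hit) | just s | refl | true | true | false =
        refl , refl , x , trans (cong (λ c → pending c x) (sym (cores v))) Rvx , alx , refl , bit

      candidate-nothing : ∀ v → target v ≡ nothing → alive (σ v) ≡ true → lookup (label (σ v)) i ≡ true →
        ∀ x → R v x ≡ true → alive (σ x) ≡ true → lookup (label (σ x)) i ≡ true
      candidate-nothing v eq alv redv x Rvx alx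
        with alive (σ v) | lookup (label (σ v)) i
           | ∃? (λ x → blueContact i (σ v) (view X σ v) x Bool.≟ true)
      ... | true | true | yes (y , hit) with look (view X σ v) y
      ...   | just s  = contradiction eq λ ()
      ...   | nothing = contradiction (trans (sym hit) (Bool.∧-zeroʳ (pending (core (σ v)) y))) λ ()
      candidate-nothing v eq alv redv x Rvx alx | true | true | no miss
        with lookup (label (σ x)) i in bit
      ... | true  = refl
      ... | false = contradiction (x , hit) miss
        where
        hit : blueContact i (σ v) (view X σ v) x ≡ true
        hit rewrite cores v | Rvx | adjacent-seen v x Rvx | alx | bit = refl

      target-near : ∀ v a → target v ≡ just a → Reach X (suc r) a v
      target-near v a eq with candidate-just v a eq
      ... | _ , _ , x , Rvx , alx , refl , _ = reach-snoc (near x alx) (trans (X-sym x v) (R⊆X v x Rvx))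

      targets⇒≡ : ∀ v a → targets (target v) a ≡ true → target v ≡ just a
      targets⇒≡ v a eq with target v
      ... | just c = cong just (==⇒≡ eq)

      -- Via the centre `a`: an applicant is within `suc r` of it, as are all members and all other
      -- applicants.
      close : ∀ v a → target v ≡ just a → ∀ x → Reach X (suc r) a x → Reach X radius v x
      close v a eq x reach = reach-mono (≤-trans (≤-reflexive (cong (suc r +_) (sym (+-identityʳ (suc r))))) wide)
        (reach-trans (reach-sym X-sym (target-near v a eq)) reach)

      size-seen : ∀ v a → target v ≡ just a →
                  weigh (λ s → alive s ∧ (label s == a)) (view X σ₁ v) ≡ size σ a
      size-seen v a eq = trans
        (weigh-view (λ s → alive s ∧ (label s == a)) σ₁ v λ x q →
          close v a eq x (reach-mono (n≤1+n r) (near-label {σ = σ} near a x q)))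
        (∑-cong λ x → cong (λ c → alive (σ x) ∧ (label (σ x) == a) ▹ weight c) (cores x))

      pull-seen : ∀ v a → target v ≡ just a →
                  weigh (λ s → targets (proposal s) a) (view X σ₁ v) ≡ pull target a
      pull-seen v a eq = trans
        (weigh-view (λ s → targets (proposal s) a) σ₁ v λ x q →
          close v a eq x (target-near x a (targets⇒≡ x a q)))
        (∑-cong λ x → cong (λ c → targets (target x) a ▹ weight c) (cores x))

      σ₂ : Config
      σ₂ = apply decide X σ₁

      decide-nothing : ∀ v → target v ≡ nothing → σ₂ v ≡ σ₁ v
      decide-nothing v eq = cong (maybe (λ a → join a (σ₁ v) (view X σ₁ v)) (σ₁ v)) eq

      decide-just : ∀ v a → target v ≡ just a → σ₂ v ≡ join a (σ₁ v) (view X σ₁ v)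
      decide-just v a eq = cong (maybe (λ a → join a (σ₁ v) (view X σ₁ v)) (σ₁ v)) eq

      -- Since the sums taken in the views equal the global ones, proposing and deciding locally
      -- realise one abstract round of the clustering.
      is-step : Step i σ σ₂
      is-step = record
        { target     = target
        ; keep-alive = λ v eq → cong alive (decide-nothing v eq)
        ; keep-label = λ v eq → cong label (decide-nothing v eq)
        ; move-alive = λ v a eq → trans (cong alive (decide-just v a eq))
            (cong₂ (λ z p → z <ᵇ margin * p) (size-seen v a eq) (pull-seen v a eq))
        ; move-label = λ v a eq → cong label (decide-just v a eq)
        ; red        = λ v a eq → proj₁ (proj₂ (candidate-just v a eq))
        ; red-alive  = λ v a eq → proj₁ (candidate-just v a eq)
        ; blue       = λ v a eq → case candidate-just v a eq of λ { (_ , _ , _ , _ , _ , _ , bit) → bit }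
        ; contact    = λ v a eq → case candidate-just v a eq of λ
            { (_ , _ , x , Rvx , alx , lx , _) → x , Rvx , alx , lx }
        ; no-contact = candidate-nothing
        }

      next-frame : Frame (suc r) σ₂
      next-frame = record { cores = cores₂ ; near = near-step is-step near }
        where
        by-target : ∀ v p → target v ≡ p → core (σ₂ v) ≡ κ v
        by-target v nothing  eq = trans (cong core (decide-nothing v eq)) (cores v)
        by-target v (just a) eq = trans (cong core (decide-just v a eq)) (cores v)
        cores₂ : ∀ v → core (σ₂ v) ≡ κ v
        cores₂ v = by-target v (target v) refl

    -- `r` is the cluster radius inherited from earlier phases and `s` the number of rounds since;
    -- `Q` collects the bits already treated.
    record InPhase (Q : Fin b → Set) (alive₀ : Key b → Bool) (i : Fin b) (r s : ℕ) (σ : Config) : Set where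
      field
        frame    : Frame (s + r) σ
        agreed   : ∀ j → Q j → AgreeAt σ j
        underway : Phase alive₀ i s σ

    in-phase : ∀ {Q alive₀ i r} → steps + r ≤ b * steps → ∀ k s σ → k + s ≤ steps →
               InPhase Q alive₀ i r s σ → InPhase Q alive₀ i r (k + s) (exec (repeat k (round i)) X σ)
    in-phase                 r-small zero    s σ k≤ ip = ip
    in-phase {Q} {alive₀} {i} {r} r-small (suc k) s σ k≤ ip =
      subst (λ n → InPhase Q alive₀ i r n (exec (repeat k (round i)) X σ₂)) (+-suc k s)
        (in-phase r-small k (suc s) σ₂ (≤-trans (≤-reflexive (+-suc k s)) k≤) record
          { frame    = next-frame
          ; agreed   = λ j Qj → StepProperties.agree-step is-step j (agreed j Qj)
          ; underway = phase-step alive₀ is-step underway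
          })
      where
      open InPhase ip
      -- At least one round is left in the phase, so `suc (s + r)` is at most `steps + r` and thus
      -- at most the final radius `b * steps`.
      wide : 2 * suc (s + r) ≤ radius
      wide = ≤-trans (*-monoʳ-≤ 2 (≤-trans (+-monoˡ-≤ r (≤-trans (s≤s (m≤n+m s k)) k≤)) r-small)) radius-wide
      open Round i (s + r) σ frame wide

    -- The situation after `p` phases, each of which contributed one `∑ w` to the bound on
    -- `margin * dead σ`.
    record Separated (p : ℕ) (Q : Fin b → Set) (σ : Config) : Set where
      field
        frame    : Frame (p * steps) σ
        agreed   : ∀ j → Q j → AgreeAt σ j
        few-dead : margin * dead σ ≤ p * ∑ w

    separate-phase : ∀ i {p Q σ} → suc p ≤ b → Separated p Q σ →
                     Separated (suc p) (λ j → j ≡ i ⊎ Q j) (exec (phase i) X σ)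
    separate-phase i {p} {Q} {σ} p<b sep = record
      { frame    = InPhase.frame done
      ; agreed   = λ { j (inj₁ refl) → separated ; j (inj₂ Qj) → InPhase.agreed done j Qj }
      ; few-dead = ≤-trans dead-step
          (≤-trans (+-monoˡ-≤ (∑ w) (Separated.few-dead sep)) (≤-reflexive (+-comm _ (∑ w))))
      }
      where
      alive₀ = λ v → alive (σ v)
      done : InPhase Q alive₀ i (p * steps) steps (exec (phase i) X σ)
      done = subst (λ n → InPhase Q alive₀ i (p * steps) n (exec (phase i) X σ)) (+-identityʳ steps)
        (in-phase (*-monoˡ-≤ steps p<b) steps 0 σ (≤-reflexive (+-identityʳ steps)) record
          { frame    = Separated.frame sep
          ; agreed   = Separated.agreed sep
          ; underway = phase-start i σ
          })
      open PhaseEnd alive₀ {i} {doublings} w-small (InPhase.underway done)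

    weaken : ∀ {p σ} {Q Q′ : Fin b → Set} → (∀ j → Q′ j → Q j) → Separated p Q σ → Separated p Q′ σ
    weaken Q′⇒Q sep = record
      { frame    = Separated.frame sep
      ; agreed   = λ j Q′j → Separated.agreed sep j (Q′⇒Q j Q′j)
      ; few-dead = Separated.few-dead sep
      }

    separate : ∀ is {p Q σ} → length is + p ≤ b → Separated p Q σ →
               Separated (length is + p) (λ j → j ∈ is ⊎ Q j) (exec (List.concatMap phase is) X σ)
    separate []       bound sep = weaken (λ { j (inj₂ Qj) → Qj }) sep
    separate (i ∷ is) {p} {Q} {σ} bound sep =
      weaken (λ { j (inj₁ (here refl)) → inj₂ (inj₁ refl)
                ; j (inj₁ (there j∈is)) → inj₁ j∈is
                ; j (inj₂ Qj) → inj₂ (inj₂ Qj) })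
        (subst₂ (λ n τ → Separated n (λ j → j ∈ is ⊎ (j ≡ i ⊎ Q j)) τ)
          (+-suc (length is) p) (sym (exec-++ (phase i) (List.concatMap phase is) X σ))
          (separate is (≤-trans (≤-reflexive (+-suc (length is) p)) bound)
            (separate-phase i (≤-trans (s≤s (m≤n+m p (length is))) bound) sep)))

    record Clustered (σ : Config) : Set where
      field
        frame    : Frame (b * steps) σ
        uniform  : ∀ v x → R v x ≡ true → alive (σ v) ≡ true → alive (σ x) ≡ true → label (σ v) ≡ label (σ x)
        few-dead : 4 * dead σ ≤ ∑ w

    clustered : ∀ σ → (∀ v → core (σ v) ≡ κ v) →
                Clustered (exec (List.concatMap phase (List.allFin b)) X (apply reset X σ))
    clustered σ cores = record
      { frame    = subst (λ n → Frame (n * steps) τ) all (Separated.frame sep)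
      ; uniform  = λ v x Rvx alv alx → lookup-ext _ _ λ j →
          Separated.agreed sep j (inj₁ (∈-allFin j)) v x Rvx alv alx
      -- The factor is `suc b` and not `b` so that it can be cancelled when `b` is 0.
      ; few-dead = *-cancelˡ-≤ (suc b) (begin
          suc b * (4 * dead τ)                    ≡⟨ shuffle (suc b) (dead τ) ⟩
          4 * suc b * dead τ                      ≤⟨ *-monoˡ-≤ (dead τ) margin-wide ⟩
          margin * dead τ                         ≤⟨ Separated.few-dead sep ⟩
          (length (List.allFin b) + 0) * ∑ w      ≡⟨ cong (_* ∑ w) all ⟩
          b * ∑ w                                 ≤⟨ m≤n+m (b * ∑ w) (∑ w) ⟩
          suc b * ∑ w                             ∎)
      }
      where
      open ≤-Reasoning
      τ = exec (List.concatMap phase (List.allFin b)) X (apply reset X σ)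
      all : length (List.allFin b) + 0 ≡ b
      all = trans (+-identityʳ _) (List.length-tabulate id)
      shuffle : ∀ p d → p * (4 * d) ≡ 4 * p * d
      shuffle = ℕ-Solver.solve-∀
      sep = separate (List.allFin b) {0} {λ _ → ⊥} (≤-reflexive all) record
        { frame    = record { cores = cores ; near = λ v _ → here }
        ; agreed   = λ j ()
        ; few-dead = ≤-reflexive (trans (cong (margin *_) (∑-zero {f = λ v → not (alive (apply reset X σ v)) ▹ w v} λ _ → refl)) (*-zeroʳ margin))
        }

    module Painting (σ : Config) (cl : Clustered σ) where
      open Clustered cl
      open Frame frame

      member : Key b → Key b → Bool
      member a x = alive (σ x) ∧ (label (σ x) == a)

      roster : Key b → Table b (Maybe (Core b))
      roster a = tab λ x → if member a x then just (core (σ x)) else nothing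

      -- Two members are each within `b * steps` of the centre, hence within `radius` of each other,
      -- so the view contains the whole cluster.
      roster-seen : ∀ v → alive (σ v) ≡ true → cluster (label (σ v)) (view X σ v) ≡ roster (label (σ v))
      roster-seen v alv = tab-cong entry
        where
        a = label (σ v)
        entry : ∀ x → maybe (λ s → if alive s ∧ (label s == a) then just (core s) else nothing) nothing
                            (look (view X σ v) x)
                      ≡ (if member a x then just (core (σ x)) else nothing)
        entry x with look (view X σ v) x in eq
        ... | just s rewrite look-view⁻ σ v x eq = refl
        ... | nothing with member a x in mem
        ...   | false = refl
        ...   | true  = contradiction (trans (sym eq) (look-view σ v x (reach-mono wide
                (reach-trans (reach-sym X-sym (near v alv)) (near-label {σ = σ} near a x mem))))) λ ()
          where
          wide : b * steps + b * steps ≤ radius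
          wide = ≤-trans (≤-reflexive (cong (b * steps +_) (sym (+-identityʳ (b * steps))))) radius-wide

      module _ (a : Key b) where

        inside : Key b → Bool
        inside x = is-just (look (roster a) x)

        nbrᵃ : Adjacency b
        nbrᵃ x y = maybe (λ c → nbr c y) false (look (roster a) x)

        colourᵃ : EdgeColouring b
        colourᵃ x y = maybe (λ c → colour c y) nothing (look (roster a) x)

        inside≡member : ∀ x → inside x ≡ member a x
        inside≡member x rewrite look-tab (λ y → if member a y then just (core (σ y)) else nothing) x
          with member a x
        ... | true  = refl
        ... | false = refl

        nbrᵃ≡ : ∀ x y → inside x ≡ true → nbrᵃ x y ≡ X x y
        nbrᵃ≡ x y eq rewrite look-tab (λ z → if member a z then just (core (σ z)) else nothing) x
          with member a x
        ... | true rewrite cores x = κ-nbr x y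

        colourᵃ≡ : ∀ x y → inside x ≡ true → colourᵃ x y ≡ colour (κ x) y
        colourᵃ≡ x y eq rewrite look-tab (λ z → if member a z then just (core (σ z)) else nothing) x
          with member a x
        ... | true rewrite cores x = refl

        open Greedy inside nbrᵃ
        open Greedy.Valid

        valid-start : Valid Δ colourᵃ
        valid-start = record
          { symmetric = λ x y ix iy → trans (colourᵃ≡ x y ix)
              (trans (symmetric κ-valid x y refl refl) (sym (colourᵃ≡ y x iy)))
          ; proper    = λ x u v c ix eu ev → proper κ-valid x u v c refl
              (trans (sym (colourᵃ≡ x u ix)) eu) (trans (sym (colourᵃ≡ x v ix)) ev)
          ; supported = λ x u c ix eq → trans (nbrᵃ≡ x u ix)
              (supported κ-valid x u c refl (trans (sym (colourᵃ≡ x u ix)) eq))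
          ; small     = λ x u c ix eq → small κ-valid x u c refl (trans (sym (colourᵃ≡ x u ix)) eq)
          }

        painted : EdgeColouring b
        painted = greedy colourᵃ

        painted-valid : Valid Δ painted
        painted-valid = greedy-valid
          (λ x y ix iy → trans (nbrᵃ≡ x y ix) (trans (X-sym x y) (sym (nbrᵃ≡ y x iy))))
          (λ x ix → ≤-trans (≤-reflexive (∑-cong λ u → cong (_▹ 1) (nbrᵃ≡ x u ix))) (degree x))
          colourᵃ valid-start

        painted-outside : ∀ x y → inside x ≡ true → inside y ≡ false → painted x y ≡ colour (κ x) y
        painted-outside x y ix oy = trans
          (greedy-outside colourᵃ x y (trans (cong (_∧ inside y) ix) oy)) (colourᵃ≡ x y ix)

        painted-complete : ∀ x y → inside x ≡ true → inside y ≡ true → X x y ≡ true → is-just (painted x y) ≡ true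
        painted-complete x y ix iy Xxy = greedy-complete colourᵃ x y ix iy (trans (nbrᵃ≡ x y ix) Xxy)

        painted-keeps : ∀ x y → inside x ≡ true → is-just (colour (κ x) y) ≡ true → is-just (painted x y) ≡ true
        painted-keeps x y ix eq = greedy-keeps colourᵃ x y (trans (cong is-just (colourᵃ≡ x y ix)) eq)

      home : Key b → Key b → Bool
      home v = inside (label (σ v))

      home-self : ∀ v → alive (σ v) ≡ true → home v v ≡ true
      home-self v alv = trans (inside≡member (label (σ v)) v)
        (trans (cong (_∧ (label (σ v) == label (σ v))) alv) (==-refl (label (σ v))))

      home⁻ : ∀ v u → home v u ≡ true → alive (σ u) ≡ true × label (σ u) ≡ label (σ v)
      home⁻ v u eq with alive (σ u) | trans (sym (inside≡member (label (σ v)) u)) eq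
      ... | true | same = refl , ==⇒≡ same

      home-sym : ∀ v u → alive (σ v) ≡ true → alive (σ u) ≡ true → home v u ≡ home u v
      home-sym v u alv alu = begin
        home v u                                    ≡⟨ inside≡member (label (σ v)) u ⟩
        alive (σ u) ∧ (label (σ u) == label (σ v))  ≡⟨ cong₂ _∧_ (trans alu (sym alv)) (==-sym (label (σ u)) (label (σ v))) ⟩
        alive (σ v) ∧ (label (σ v) == label (σ u))  ≡⟨ inside≡member (label (σ u)) v ⟨
        home u v                                    ∎
        where open ≡-Reasoning

      σ′ : Config
      σ′ = apply paintCluster X σ

      new : EdgeColouring b
      new v u = colour (core (σ′ v)) u

      new-alive : ∀ v u → alive (σ v) ≡ true → new v u ≡ painted (label (σ v)) v u
      new-alive v u alv rewrite alv = cong (λ t → colourCluster t v u) (roster-seen v alv)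

      new-dead : ∀ v u → alive (σ v) ≡ false → new v u ≡ colour (κ v) u
      new-dead v u dead-v rewrite dead-v | cores v = refl

      new-nbr : ∀ v u → nbr (core (σ′ v)) u ≡ X v u
      new-nbr v u with alive (σ v)
      ... | true  = trans (cong (λ c → nbr c u) (cores v)) (κ-nbr v u)
      ... | false = trans (cong (λ c → nbr c u) (cores v)) (κ-nbr v u)

      -- Greedy paints only pairs with both ends in the cluster. Hence an edge between clusters, or
      -- at a dead vertex, keeps its old colour as seen from either end.
      new-crossing : ∀ v u → alive (σ v) ≡ false ⊎ home v u ≡ false → new v u ≡ colour (κ v) u
      new-crossing v u (inj₁ dead-v) = new-dead v u dead-v
      new-crossing v u (inj₂ away) with bool? (alive (σ v))
      ... | inj₂ alv = new-dead v u alv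
      ... | inj₁ alv = trans (new-alive v u alv) (painted-outside (label (σ v)) v u (home-self v alv) away)

      open Greedy.Valid

      κ-symmetric : ∀ v u → colour (κ v) u ≡ colour (κ u) v
      κ-symmetric v u = symmetric κ-valid v u refl refl

      away-dead : ∀ v u → alive (σ u) ≡ false → home v u ≡ false
      away-dead v u dead-u = trans (inside≡member (label (σ v)) u) (cong (_∧ (label (σ u) == label (σ v))) dead-u)

      -- Ends in a common cluster read the colour off the same painted roster; otherwise neither end
      -- changes the old, symmetric colour.
      new-symmetric : ∀ v u → new v u ≡ new u v
      new-symmetric v u with bool? (alive (σ v)) | bool? (alive (σ u))
      ... | inj₂ alv | _        = trans (new-dead v u alv)
        (trans (κ-symmetric v u) (sym (new-crossing u v (inj₂ (away-dead u v alv)))))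
      ... | inj₁ alv | inj₂ alu = trans (new-crossing v u (inj₂ (away-dead v u alu)))
        (trans (κ-symmetric v u) (sym (new-dead u v alu)))
      ... | inj₁ alv | inj₁ alu with bool? (home v u)
      ...   | inj₂ hvu = trans (new-crossing v u (inj₂ hvu)) (trans (κ-symmetric v u)
        (sym (new-crossing u v (inj₂ (trans (sym (home-sym v u alv alu)) hvu)))))
      ...   | inj₁ hvu = begin
        new v u                    ≡⟨ new-alive v u alv ⟩
        painted (label (σ v)) v u  ≡⟨ symmetric (painted-valid (label (σ v))) v u (home-self v alv) hvu ⟩
        painted (label (σ v)) u v  ≡⟨ cong (λ a → painted a u v) (proj₂ (home⁻ v u hvu)) ⟨
        painted (label (σ u)) u v  ≡⟨ new-alive u v alu ⟨
        new u v                    ∎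
        where open ≡-Reasoning

      good : Good σ′
      good = record
        { nbrs  = new-nbr
        ; valid = record
          { symmetric = λ v u _ _ → new-symmetric v u
          ; proper    = λ x u v c _ → new-proper x u v c
          ; supported = λ x u c _ → new-supported x u c
          ; small     = λ x u c _ → new-small x u c
          }
        }
        where
        new-proper : ∀ x u v c → new x u ≡ just c → new x v ≡ just c → u ≡ v
        new-proper x u v c eu ev with bool? (alive (σ x))
        ... | inj₂ alx = proper κ-valid x u v c refl
          (trans (sym (new-dead x u alx)) eu) (trans (sym (new-dead x v alx)) ev)
        -- Validity of the painted cluster covers the whole row of `x`, including the edges that
        -- leave the cluster.
        ... | inj₁ alx = proper (painted-valid (label (σ x))) x u v c (home-self x alx)
          (trans (sym (new-alive x u alx)) eu) (trans (sym (new-alive x v alx)) ev)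
        new-supported : ∀ x u c → new x u ≡ just c → X x u ≡ true
        new-supported x u c eq with bool? (alive (σ x))
        ... | inj₂ alx = supported κ-valid x u c refl (trans (sym (new-dead x u alx)) eq)
        ... | inj₁ alx = trans (sym (nbrᵃ≡ (label (σ x)) x u (home-self x alx)))
          (supported (painted-valid (label (σ x))) x u c (home-self x alx) (trans (sym (new-alive x u alx)) eq))
        new-small : ∀ x u c → new x u ≡ just c → c < Δ + Δ
        new-small x u c eq with bool? (alive (σ x))
        ... | inj₂ alx = small κ-valid x u c refl (trans (sym (new-dead x u alx)) eq)
        ... | inj₁ alx = small (painted-valid (label (σ x))) x u c (home-self x alx) (trans (sym (new-alive x u alx)) eq)

      keeps : ∀ v u → is-just (colour (κ v) u) ≡ true → is-just (new v u) ≡ true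
      keeps v u eq with bool? (alive (σ v))
      ... | inj₂ alv = trans (cong is-just (new-dead v u alv)) eq
      ... | inj₁ alv = trans (cong is-just (new-alive v u alv))
                          (painted-keeps (label (σ v)) v u (home-self v alv) eq)

      completes : ∀ v u → R v u ≡ true → alive (σ v) ≡ true → alive (σ u) ≡ true → is-just (new v u) ≡ true
      completes v u Rvu alv alu = trans (cong is-just (new-alive v u alv))
        (painted-complete (label (σ v)) v u (home-self v alv) at-home (R⊆X v u Rvu))
        where
        at-home : home v u ≡ true
        at-home = trans (inside≡member (label (σ v)) u) (trans (cong (_∧ (label (σ u) == label (σ v))) alu)
          (trans (cong (_== label (σ v)) (sym (uniform v u Rvu alv alu))) (==-refl (label (σ v)))))

      -- Colours are never erased, and an uncoloured edge between survivors lies in one cluster and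
      -- gets painted; so an edge that remains uncoloured has a dead end.
      still-pending : ∀ v u → pending (core (σ′ v)) u ≡ true →
                      R v u ≡ true × (alive (σ v) ≡ false ⊎ alive (σ u) ≡ false)
      still-pending v u open′ = Rvu , dead-end (bool? (alive (σ v))) (bool? (alive (σ u)))
        where
        p = nbr (core (σ′ v)) u
        Xvu : X v u ≡ true
        Xvu = trans (sym (new-nbr v u)) (Bool.∧-conicalˡ p _ open′)
        uncoloured : is-just (new v u) ≢ true
        uncoloured = is-nothing⇒¬is-just (new v u) (Bool.∧-conicalʳ p _ open′)
        Rvu : R v u ≡ true
        Rvu = cong₂ _∧_ (trans (κ-nbr v u) Xvu)
          (¬is-just⇒is-nothing (colour (κ v) u) λ old → uncoloured (keeps v u old))
        dead-end : alive (σ v) ≡ true ⊎ alive (σ v) ≡ false → alive (σ u) ≡ true ⊎ alive (σ u) ≡ false →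
                   alive (σ v) ≡ false ⊎ alive (σ u) ≡ false
        dead-end (inj₂ dead-v) _             = inj₁ dead-v
        dead-end (inj₁ _)      (inj₂ dead-u) = inj₂ dead-u
        dead-end (inj₁ alv)    (inj₁ alu)    = contradiction (completes v u Rvu alv alu) uncoloured

      pending′ : ∀ v u → (pending (core (σ′ v)) u ▹ 1)
                         ≤ (not (alive (σ v)) ▹ R v u ▹ 1) + (not (alive (σ u)) ▹ R v u ▹ 1)
      pending′ v u = charge _ (R v u) (alive (σ v)) (alive (σ u)) (still-pending v u)
        where
        charge : ∀ p r a c → (p ≡ true → r ≡ true × (a ≡ false ⊎ c ≡ false)) →
                 (p ▹ 1) ≤ (not a ▹ r ▹ 1) + (not c ▹ r ▹ 1)
        charge false r a c h = z≤n
        charge true  r a c h with h refl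
        ... | refl , inj₁ refl = s≤s z≤n
        ... | refl , inj₂ refl = m≤n+m 1 _

      -- Charging each remaining uncoloured pair to a dead end gives at most twice the dead weight,
      -- which is at most half of `∑ w`.
      halved : 2 * total σ′ ≤ ∑ w
      halved = begin
        2 * total σ′                                  ≤⟨ *-monoʳ-≤ 2 (∑-mono λ v → ∑-mono (pending′ v)) ⟩
        2 * ∑ (λ v → ∑ λ u → from v u + to v u)       ≡⟨ cong (2 *_) (∑-cong λ v → ∑-+ (from v) (to v)) ⟩
        2 * ∑ (λ v → ∑ (from v) + ∑ (to v))           ≡⟨ cong (2 *_) (∑-+ (λ v → ∑ (from v)) (λ v → ∑ (to v))) ⟩
        2 * (∑ (λ v → ∑ (from v)) + ∑ (λ v → ∑ (to v))) ≡⟨ cong₂ (λ p q → 2 * (p + q)) from-dead to-dead ⟩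
        2 * (dead σ + dead σ)                         ≡⟨ quadruple (dead σ) ⟩
        4 * dead σ                                    ≤⟨ few-dead ⟩
        ∑ w                                           ∎
        where
        open ≤-Reasoning
        from to : Key b → Key b → ℕ
        from v u = not (alive (σ v)) ▹ R v u ▹ 1
        to   v u = not (alive (σ u)) ▹ R v u ▹ 1
        from-dead : ∑ (λ v → ∑ (from v)) ≡ dead σ
        from-dead = ∑-cong λ v → ∑-▹ (not (alive (σ v))) (λ u → R v u ▹ 1)
        to-dead : ∑ (λ v → ∑ (to v)) ≡ dead σ
        to-dead = trans (∑-swap to) (trans
          (∑-cong λ u → ∑-cong λ v → cong (λ p → not (alive (σ u)) ▹ p ▹ 1) (R-sym v u)) from-dead)
        quadruple : ∀ d → 2 * (d + d) ≡ 4 * d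
        quadruple = ℕ-Solver.solve-∀

  iterate : ∀ σ → Good σ → Good (exec iteration X σ) × 2 * total (exec iteration X σ) ≤ total σ
  iterate σ g rewrite exec-++ (List.concatMap phase (List.allFin b)) (paintCluster ∷ []) X (apply reset X σ) =
    good , halved
    where
    open OneIteration (λ v → core (σ v)) (Good.nbrs g) (Good.valid g)
    open Painting _ (clustered σ λ _ → refl)

  iterates : ∀ k σ → Good σ → Good (exec (repeat k iteration) X σ) ×
                              2 ^ k * total (exec (repeat k iteration) X σ) ≤ total σ
  iterates zero    σ g = g , ≤-reflexive (+-identityʳ _)
  iterates (suc k) σ g rewrite exec-++ iteration (repeat k iteration) X σ
    with iterate σ g
  ... | g₁ , h₁ with iterates k (exec iteration X σ) g₁
  ...   | g₂ , h₂ = g₂ , ≤-trans (≤-reflexive (*-assoc 2 (2 ^ k) _)) (≤-trans (*-monoʳ-≤ 2 h₂) h₁)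

  initial-good : Good (initial X)
  initial-good = record
    { nbrs  = λ v u → look-tab (X v) u
    ; valid = record
      { symmetric = λ _ _ _ _ → refl
      ; proper    = λ _ _ _ _ _ ()
      ; supported = λ _ _ _ _ ()
      ; small     = λ _ _ _ _ ()
      }
    }

  final : Config
  final = exec program X (initial X)

  final-good : Good final
  final-good = proj₁ (iterates doublings (initial X) initial-good)

  -- The initial total is below 2 to the power `doublings`; after that many halvings it is below 1.
  final-total : total final ≡ 0
  final-total = n<1⇒n≡0 (*-cancelˡ-< (2 ^ doublings) _ _ (begin-strict
    2 ^ doublings * total final  ≤⟨ proj₂ (iterates doublings (initial X) initial-good) ⟩
    total (initial X)            ≤⟨ ∑-bound (λ v → ∑-bound λ u → ▹≤ (pending (core (initial X v)) u) 1) ⟩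
    2 ^ b * (2 ^ b * 1)          ≡⟨ cong (2 ^ b *_) (*-identityʳ (2 ^ b)) ⟩
    2 ^ b * 2 ^ b                <⟨ doublings-many ⟩
    2 ^ doublings                ≡⟨ *-identityʳ (2 ^ doublings) ⟨
    2 ^ doublings * 1            ∎))
    where open ≤-Reasoning

  final-coloured : ∀ v u → X v u ≡ true → ∃ λ c → colour (core (final v)) u ≡ just c
  final-coloured v u Xvu with colour (core (final v)) u in eq
  ... | just c  = c , refl
  ... | nothing = contradiction (begin
    1                                       ≡⟨ cong (_▹ 1) still-pending ⟨
    pending (core (final v)) u ▹ 1          ≤⟨ term≤∑ (λ x → pending (core (final v)) x ▹ 1) u ⟩
    weight (core (final v))                 ≤⟨ term≤∑ (λ x → weight (core (final x))) v ⟩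
    total final                             ≡⟨ final-total ⟩
    0                                       ∎) λ ()
    where
    open ≤-Reasoning
    still-pending : pending (core (final v)) u ≡ true
    still-pending = cong₂ _∧_ (trans (Good.nbrs final-good v u) Xvu) (cong is-nothing eq)

  open Greedy.Valid

  result-symmetric : ∀ v u → result X v u ≡ result X u v
  result-symmetric v u = cong (maybe id 0) (symmetric (Good.valid final-good) v u refl refl)

  result-small : ∀ v u → X v u ≡ true → result X v u < Δ + Δ
  result-small v u Xvu with final-coloured v u Xvu
  ... | c , eq rewrite eq = small (Good.valid final-good) v u c refl eq

  result-proper : ∀ v u x → X v u ≡ true → X v x ≡ true → result X v u ≡ result X v x → u ≡ x
  result-proper v u x Xvu Xvx same with final-coloured v u Xvu | final-coloured v x Xvx
  ... | c , eu | d , ex = proper (Good.valid final-good) v u x c refl eu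
    (trans ex (cong just (trans (sym (cong (maybe id 0) ex)) (trans (sym same) (cong (maybe id 0) eu)))))

-- Numerical bounds

n<2^[1+⌊log₂n⌋] : ∀ n → n < 2 ^ suc ⌊log₂ n ⌋
n<2^[1+⌊log₂n⌋] = <-rec (λ n → n < 2 ^ suc ⌊log₂ n ⌋) bound
  where
  open ≤-Reasoning
  bound : ∀ n → (∀ {m} → m < n → m < 2 ^ suc ⌊log₂ m ⌋) → n < 2 ^ suc ⌊log₂ n ⌋
  bound 0               _   = s≤s z≤n
  bound 1               _   = s≤s (s≤s z≤n)
  bound n@(suc (suc k)) rec = begin-strict
    n                          ≡⟨ ⌊n/2⌋+⌈n/2⌉≡n n ⟨
    -- By definition ⌈n/2⌉ is ⌊(n + 1)/2⌋, which is at most ⌊(n + 2)/2⌋ = h + 1.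
    h + ⌈ n /2⌉                ≤⟨ +-monoʳ-≤ h (⌊n/2⌋-mono (n≤1+n (suc n))) ⟩
    h + suc h                  <⟨ n<1+n _ ⟩
    suc (h + suc h)            ≡⟨ double h ⟩
    2 * suc h                  ≤⟨ *-monoʳ-≤ 2 (rec (⌊n/2⌋<n (suc k))) ⟩
    2 * 2 ^ suc ⌊log₂ h ⌋      ≡⟨ cong (λ e → 2 * 2 ^ e) exponent ⟩
    2 ^ suc ⌊log₂ n ⌋          ∎
    where
    h = ⌊ n /2⌋
    double : ∀ h → suc (h + suc h) ≡ 2 * suc h
    double = ℕ-Solver.solve-∀
    exponent : suc ⌊log₂ h ⌋ ≡ ⌊log₂ n ⌋
    exponent = trans (cong suc (⌊log₂⌊n/2⌋⌋≡⌊log₂n⌋∸1 n))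
      (m+[n∸m]≡n (⌊log₂⌋-mono-≤ {2} {n} (s≤s (s≤s z≤n))))

-- Identifier lengths use the upper logarithm, the round bound the lower one.
⌈log₂n⌉≤1+⌊log₂n⌋ : ∀ n → ⌈log₂ n ⌉ ≤ suc ⌊log₂ n ⌋
⌈log₂n⌉≤1+⌊log₂n⌋ n = ≤-trans (⌈log₂⌉-mono-≤ (<⇒≤ (n<2^[1+⌊log₂n⌋] n)))
  (≤-reflexive (⌈log₂2^n⌉≡n (suc ⌊log₂ n ⌋)))

-- Order and products of embedded naturals are settled among unnormalised rationals, where the
-- denominator is visibly 1.
toℚᵘ-fromℕ : ∀ k → ℚ.toℚᵘ (fromℕ k) ℚᵘ.≃ ℚᵘ.mkℚᵘ (ℤ.+ k) 0
toℚᵘ-fromℕ k = ℚ.toℚᵘ-fromℚᵘ (ℚᵘ.mkℚᵘ (ℤ.+ k) 0)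

fromℕ-mono-≤ : ∀ {j k} → j ≤ k → fromℕ j ℚ.≤ fromℕ k
fromℕ-mono-≤ {j} {k} j≤k = ℚ.toℚᵘ-cancel-≤ (begin
  ℚ.toℚᵘ (fromℕ j)      ≃⟨ toℚᵘ-fromℕ j ⟩
  ℚᵘ.mkℚᵘ (ℤ.+ j) 0     ≤⟨ ℚᵘ.*≤* (ℤ.*-monoʳ-≤-nonNeg (ℤ.+ 1) (ℤ.+≤+ j≤k)) ⟩
  ℚᵘ.mkℚᵘ (ℤ.+ k) 0     ≃⟨ toℚᵘ-fromℕ k ⟨
  ℚ.toℚᵘ (fromℕ k)      ∎)
  where open ℚᵘ.≤-Reasoning

fromℕ-* : ∀ j k → fromℕ (j * k) ≡ fromℕ j ℚ.* fromℕ k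
fromℕ-* j k = ℚ.toℚᵘ-injective (begin-equality
  ℚ.toℚᵘ (fromℕ (j * k))                        ≃⟨ toℚᵘ-fromℕ (j * k) ⟩
  ℚᵘ.mkℚᵘ (ℤ.+ (j * k)) 0                       ≃⟨ ℚᵘ.*≡* (cong (ℤ._* ℤ.+ 1) (ℤ.pos-* j k)) ⟩
  ℚᵘ.mkℚᵘ (ℤ.+ j) 0 ℚᵘ.* ℚᵘ.mkℚᵘ (ℤ.+ k) 0      ≃⟨ ℚᵘ.*-cong (toℚᵘ-fromℕ j) (toℚᵘ-fromℕ k) ⟨
  ℚ.toℚᵘ (fromℕ j) ℚᵘ.* ℚ.toℚᵘ (fromℕ k)        ≃⟨ ℚ.toℚᵘ-homo-* (fromℕ j) (fromℕ k) ⟨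
  ℚ.toℚᵘ (fromℕ j ℚ.* fromℕ k)                  ∎)
  where open ℚᵘ.≤-Reasoning

fromℕ-nonNeg : ∀ k → ℚ.NonNegative (fromℕ k)
fromℕ-nonNeg k = ℚ.nonNegative (fromℕ-mono-≤ {0} {k} z≤n)

-- If q ≤ p, then `p` would lie in both cuts, as the upper one is closed upwards.
lower<upper : (ε : ℝ) → ∀ {p q} → p <ᴿ ε → ε ᴿ< q → p ℚ.< q
lower<upper ε {p} {q} p<ε ε<q with p ℚ.<? q
... | yes p<q = p<q
... | no  p≮q with ℚ.<-cmp p q
...   | tri< p<q _ _  = p<q
...   | tri≈ _ refl _ = contradiction (p<ε , ε<q) (ℝ.disjoint ε p)
...   | tri> _ _ q<p  = contradiction (p<ε , Equivalence.from (ℝ.upper-rounded ε p) (q , q<p , ε<q)) (ℝ.disjoint ε p)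

twice-at-most : (ε : ℝ) → 0ℚ <ᴿ ε → ∀ Δ → (AtMost[2+ ε ]* Δ) (Δ + Δ)
twice-at-most ε 0<ε Δ q ε<q = begin
  fromℕ (Δ + Δ)                   ≡⟨ cong (λ k → fromℕ (Δ + k)) (+-identityʳ Δ) ⟨
  fromℕ (2 * Δ)                   ≡⟨ fromℕ-* 2 Δ ⟩
  fromℕ 2 ℚ.* fromℕ Δ             ≤⟨ ℚ.*-monoʳ-≤-nonNeg (fromℕ Δ) {{fromℕ-nonNeg Δ}} 2≤2+q ⟩
  (fromℕ 2 ℚ.+ q) ℚ.* fromℕ Δ     ∎
  where
  open ℚ.≤-Reasoning
  2≤2+q : fromℕ 2 ℚ.≤ fromℕ 2 ℚ.+ q
  2≤2+q = begin
    fromℕ 2             ≡⟨ ℚ.+-identityʳ (fromℕ 2) ⟨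
    fromℕ 2 ℚ.+ 0ℚ      ≤⟨ ℚ.+-monoʳ-≤ (fromℕ 2) (ℚ.<⇒≤ (lower<upper ε 0<ε ε<q)) ⟩
    fromℕ 2 ℚ.+ q       ∎

-- If the logarithm is 0, then t ≤ C and the maximum is at least q³. Otherwise q³ ≤ 1 and the power
-- of the logarithm alone suffices.
round-bound : ∀ n (ε : ℝ) C t → ε ᴿ< 1ℚ → t ≤ C * (1 ⊔ ⌊log₂ n ⌋) ^ 11 → RoundBound n ε C t
round-bound n ε C t ε<1 t≤ q 0<q q<ε = by-log ⌊log₂ n ⌋ t≤
  where
  open ℚ.≤-Reasoning
  q³ = q ℚ.* q ℚ.* q
  instance
    q≥0 : ℚ.NonNegative q
    q≥0 = ℚ.nonNegative (ℚ.<⇒≤ 0<q)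
    q³≥0 : ℚ.NonNegative q³
    q³≥0 = ℚ.nonNeg*nonNeg⇒nonNeg (q ℚ.* q) {{ℚ.nonNeg*nonNeg⇒nonNeg q q}} q
    t≥0 = fromℕ-nonNeg t
    C≥0 = fromℕ-nonNeg C
  q≤1 : q ℚ.≤ 1ℚ
  q≤1 = ℚ.<⇒≤ (lower<upper ε q<ε ε<1)
  q³≤1 : q³ ℚ.≤ 1ℚ
  q³≤1 = begin
    q ℚ.* q ℚ.* q      ≤⟨ ℚ.*-monoʳ-≤-nonNeg q (ℚ.*-monoʳ-≤-nonNeg q q≤1) ⟩
    1ℚ ℚ.* q ℚ.* q     ≡⟨ cong (ℚ._* q) (ℚ.*-identityˡ q) ⟩
    q ℚ.* q            ≤⟨ ℚ.*-monoʳ-≤-nonNeg q q≤1 ⟩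
    1ℚ ℚ.* q           ≡⟨ ℚ.*-identityˡ q ⟩
    q                  ≤⟨ q≤1 ⟩
    1ℚ                 ∎
  by-log : ∀ l → t ≤ C * (1 ⊔ l) ^ 11 → fromℕ t ℚ.* q³ ℚ.≤ fromℕ C ℚ.* (q³ ℚ.⊔ fromℕ (l ^ 11))
  by-log zero h = begin
    fromℕ t ℚ.* q³                            ≤⟨ ℚ.*-monoʳ-≤-nonNeg q³ (fromℕ-mono-≤ (≤-trans h (≤-reflexive (*-identityʳ C)))) ⟩
    fromℕ C ℚ.* q³                            ≤⟨ ℚ.*-monoˡ-≤-nonNeg (fromℕ C) (ℚ.p≤p⊔q q³ (fromℕ 0)) ⟩
    fromℕ C ℚ.* (q³ ℚ.⊔ fromℕ 0)              ∎
  by-log l@(suc _) h = begin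
    fromℕ t ℚ.* q³                            ≤⟨ ℚ.*-monoˡ-≤-nonNeg (fromℕ t) q³≤1 ⟩
    fromℕ t ℚ.* 1ℚ                            ≡⟨ ℚ.*-identityʳ (fromℕ t) ⟩
    fromℕ t                                   ≤⟨ fromℕ-mono-≤ h ⟩
    fromℕ (C * l ^ 11)                        ≡⟨ fromℕ-* C (l ^ 11) ⟩
    fromℕ C ℚ.* fromℕ (l ^ 11)                ≤⟨ ℚ.*-monoˡ-≤-nonNeg (fromℕ C) (ℚ.p≤q⊔p q³ (fromℕ (l ^ 11))) ⟩
    fromℕ C ℚ.* (q³ ℚ.⊔ fromℕ (l ^ 11))       ∎

^-distribʳ-* : ∀ m n k → (m * n) ^ k ≡ m ^ k * n ^ k
^-distribʳ-* m n zero    = refl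
^-distribʳ-* m n (suc k) = trans (cong (m * n *_) (^-distribʳ-* m n k)) (shuffle m n (m ^ k) (n ^ k))
  where
  shuffle : ∀ m n p q → m * n * (p * q) ≡ m * p * (n * q)
  shuffle = ℕ-Solver.solve-∀

-- The least convenient parameters for `Correctness`. The program has O(b⁴) updates: O(b) iterations
-- of b phases with O(b²) rounds. As `radius` is O(b³), the horizon is O(b⁷).
module Schedule (b : ℕ) where

  margin doublings radius : ℕ
  margin    = 4 * suc b
  doublings = 2 * suc b
  radius    = 2 * (b * (margin * doublings))

  open Algorithm b radius margin doublings public

  doublings-many : 2 ^ b * 2 ^ b < 2 ^ doublings
  doublings-many = ≤-<-trans (≤-reflexive (sym (^-distribˡ-+-* 2 b b)))
    (^-monoʳ-< 2 (s≤s (s≤s z≤n)) (≤-trans (≤-reflexive (sym (cong (λ k → suc (b + k)) (+-identityʳ b))))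
      (s≤s (+-monoʳ-≤ b (n≤1+n (b + 0))))))

  length-repeat : ∀ {A : Set} k (xs : List A) → length (repeat k xs) ≡ k * length xs
  length-repeat zero    xs = refl
  length-repeat (suc k) xs = trans (List.length-++ xs) (cong (length xs +_) (length-repeat k xs))

  length-concatMap : ∀ {A C : Set} (f : A → List C) l → (∀ x → length (f x) ≡ l) →
                     ∀ xs → length (List.concatMap f xs) ≡ length xs * l
  length-concatMap f l eq []       = refl
  length-concatMap f l eq (x ∷ xs) = trans (List.length-++ (f x)) (cong₂ _+_ (eq x) (length-concatMap f l eq xs))

  length-program : length program ≡ doublings * suc (b * (margin * doublings * 2) + 1)
  length-program = trans (length-repeat doublings iteration) (cong (λ l → doublings * suc l)
    (trans (List.length-++ (List.concatMap phase (List.allFin b))) (cong (_+ 1)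
      (trans (length-concatMap phase _ (λ i → length-repeat (margin * doublings) (round i)) (List.allFin b))
             (cong (_* (margin * doublings * 2)) (List.length-tabulate {n = b} id))))))

  horizon-bound : horizon ≤ 512 * suc b ^ 7
  horizon-bound = begin
    length program * radius                                       ≡⟨ cong (_* radius) length-program ⟩
    doublings * suc (b * (margin * doublings * 2) + 1) * radius   ≤⟨ *-mono-≤ (*-monoʳ-≤ doublings short) near ⟩
    doublings * (suc b * (margin * doublings * 2)) * (2 * (suc b * (margin * doublings))) ≡⟨ expand (suc b) ⟩
    512 * suc b ^ 7                                               ∎
    where
    open ≤-Reasoning
    s = margin * doublings * 2
    -- The two extra updates of an iteration, `reset` and `paintCluster`, are absorbed by raising
    -- `b` to `suc b`, since s ≥ 2.
    short : suc (b * s + 1) ≤ suc b * s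
    short = ≤-trans (≤-reflexive (cong suc (+-comm (b * s) 1)))
      (+-monoˡ-≤ (b * s) (*-mono-≤ {1} {margin * doublings} {2} (s≤s z≤n) ≤-refl))
    near : radius ≤ 2 * (suc b * (margin * doublings))
    near = *-monoʳ-≤ 2 (*-monoˡ-≤ (margin * doublings) (n≤1+n b))
    expand : ∀ B → 2 * B * (B * (4 * B * (2 * B) * 2)) * (2 * (B * (4 * B * (2 * B)))) ≡
                   512 * (B * (B * (B * (B * (B * (B * (B * 1)))))))
    expand = ℕ-Solver.solve-∀

-- Running the algorithm by flooding

-- `K i j` holds if the edge is known from the row of `i`. Rows spread one hop per round, so `K` may
-- be asymmetric at the rim of the known ball. In the end the node replays the whole algorithm on
-- `K`.
greedyColouring : ∀ b → NodeProgram (Key b)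
greedyColouring b = record
  { State   = Key b × Adjacency b
  ; Message = Adjacency b
  ; init    = λ own nbr → own , λ i j → (i == own) ∧ nbr j
  ; send    = λ (_ , K) _ → K
  ; receive = λ (own , K) inbox → own , λ i j →
      K i j ∨ does (∃? λ k → maybe (λ K′ → K′ i j) false (inbox k) Bool.≟ true)
  ; output  = λ (own , K) i → result K own i
  ; rounds  = horizon
  }
  where open Schedule b

module Flooding {c n} (G : Graph n) (ident : Fin n → ID c n) (ident-inj : Injective _≡_ _≡_ ident) where

  open Graph G using (adj; degree; symmetric)
  open Schedule (idLength c n)
  open Execution {c} {n} (greedyColouring (idLength c n)) G ident using (neighbour; neighbour?; state)

  edge? : ∀ i j → Dec (∃ λ u → ident u ≡ i × ∃ λ w → adj u w ≡ true × ident w ≡ j)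
  edge? i j = Fin.any? λ u → ident u ≟ i ×-dec Fin.any? λ w → adj u w Bool.≟ true ×-dec ident w ≟ j

  X : Adjacency (idLength c n)
  X i j = does (edge? i j)

  X⁺ : ∀ {u w} → adj u w ≡ true → X (ident u) (ident w) ≡ true
  X⁺ {u} {w} uw = dec-true (edge? (ident u) (ident w)) (u , refl , w , uw , refl)

  X⁻ : ∀ {i j} → X i j ≡ true → ∃ λ u → ident u ≡ i × ∃ λ w → adj u w ≡ true × ident w ≡ j
  X⁻ {i} {j} eq with edge? i j
  ... | yes e = e

  X⁻-from : ∀ {u j} → X (ident u) j ≡ true → ∃ λ w → adj u w ≡ true × ident w ≡ j
  X⁻-from Xuj with X⁻ Xuj
  ... | u′ , eq , e with ident-inj eq
  ...   | refl = e

  X-sym : ∀ i j → X i j ≡ X j i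
  X-sym i j = Bool.⇔→≡ (mk⇔ flip flip)
    where
    flip : ∀ {i j} → X i j ≡ true → X j i ≡ true
    flip Xij with X⁻ Xij
    ... | u , refl , w , uw , refl = X⁺ (trans (symmetric w u) uw)

  neighbour⁺ : ∀ {v u} → adj v u ≡ true → neighbour v (ident u) ≡ just u
  neighbour⁺ {v} {u} vu with neighbour? v (ident u)
  ... | yes (u′ , _ , eq) = cong just (ident-inj eq)
  ... | no ¬nbr           = contradiction (u , T-≡⁻ vu , refl) ¬nbr
    where
    T-≡⁻ : ∀ {p} → p ≡ true → T p
    T-≡⁻ refl = _

  neighbour⁻ : ∀ {v i u} → neighbour v i ≡ just u → adj v u ≡ true × ident u ≡ i
  neighbour⁻ {v} {i} eq with neighbour? v i
  neighbour⁻ refl | yes (u , vu , eq) = Equivalence.to Bool.T-≡ vu , eq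

  K : ℕ → Fin n → Adjacency (idLength c n)
  K t v = proj₂ (state t v)

  own : ∀ t v → proj₁ (state t v) ≡ ident v
  own zero    v = refl
  own (suc t) v = own t v

  K-sound : ∀ t v {i j} → K t v i j ≡ true → X i j ≡ true
  K-sound zero v {i} {j} eq with i ≟ ident v
  ... | yes refl with neighbour v j in nb
  ...   | just u with neighbour⁻ nb
  ...     | vu , refl = X⁺ vu
  K-sound (suc t) v {i} {j} eq with K t v i j in here-first
  ... | true = K-sound t v here-first
  ... | false with ∃? (λ k → maybe (λ K′ → K′ i j) false (Maybe.map (K t) (neighbour v k)) Bool.≟ true)
  ...   | yes (k , heard) with neighbour v k
  ...     | just u = K-sound t u heard

  -- The first neighbour on a walk to `i` knows the row of `i` one round earlier and passes it on.
  K-complete : ∀ t v {i} → Reach X t (ident v) i → ∀ {j} → X i j ≡ true → K t v i j ≡ true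
  K-complete zero v here {j} Xvj with X⁻-from Xvj
  ... | w , vw , refl rewrite ==-refl (ident v) | neighbour⁺ vw = refl
  K-complete (suc t) v here {j} Xvj rewrite K-complete t v here Xvj = refl
  K-complete (suc t) v {i} (step Xvk r) {j} Xij with X⁻-from Xvk
  ... | w , vw , refl = trans
    (cong (K t v i j ∨_) (dec-true
      (∃? λ k → maybe (λ K′ → K′ i j) false (Maybe.map (K t) (neighbour v k)) Bool.≟ true)
      (ident w , heard)))
    (Bool.∨-zeroʳ (K t v i j))
    where
    heard : maybe (λ K′ → K′ i j) false (Maybe.map (K t) (neighbour v (ident w))) ≡ true
    heard rewrite neighbour⁺ vw = K-complete t w r Xij

  K-same : ∀ t v → SameBall t (ident v) X (K t v)
  K-same t v i r j = Bool.⇔→≡ (mk⇔ (K-complete t v r) (K-sound t v))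

  degree-bound : ∀ i → ∑ (λ j → X i j ▹ 1) ≤ maxDegree G
  degree-bound i with Fin.any? (λ u → ident u ≟ i)
  ... | yes (u , refl) = ≤-trans
    (∑-image≤ ident (adj u) (X (ident u)) (λ j Xuj → X⁻-from Xuj))
    (All.lookup (Extrema.xs≤max 0 (List.map degree (List.allFin n))) (∈-map⁺ degree (∈-allFin u)))
  ... | no ¬ident = ≤-trans (≤-reflexive (∑-zero λ j → cong (_▹ 1) (isolated j))) z≤n
    where
    isolated : ∀ j → X i j ≡ false
    isolated j = dec-false (edge? i j) λ { (u , eq , _) → ¬ident (u , eq) }

  open Correctness radius margin doublings ≤-refl doublings-many ≤-refl X X-sym (maxDegree G) degree-bound

  colours : Fin n → Fin n → ℕ
  colours = colouring {c} {n} (greedyColouring (idLength c n)) G ident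

  -- By `K-same` the known rows are correct up to distance `horizon`, so by `result-local` the
  -- replay on them gives the colours of the true graph.
  colours≡ : ∀ u v → colours u v ≡ result X (ident u) (ident v)
  colours≡ u v rewrite own horizon u = sym (result-local (K-same horizon u) (ident v))

  proper-colouring : IsProperEdgeColouring G (maxDegree G + maxDegree G) colours
  proper-colouring = record
    { consistent = λ u v uv → trans (colours≡ u v)
        (trans (result-symmetric (ident u) (ident v)) (sym (colours≡ v u)))
    ; palette    = λ u v uv → ≤-trans (≤-reflexive (cong suc (colours≡ u v)))
        (result-small (ident u) (ident v) (X⁺ (Equivalence.to Bool.T-≡ uv)))
    ; proper     = λ u v w uv uw v≢w eq → v≢w (ident-inj
        (result-proper (ident u) (ident v) (ident w)
          (X⁺ (Equivalence.to Bool.T-≡ uv)) (X⁺ (Equivalence.to Bool.T-≡ uw))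
          (trans (sym (colours≡ u v)) (trans eq (colours≡ u w)))))
    }

-- The round count and the conclusion

roundConstant : ℕ → ℕ
roundConstant c = 512 * (1 + 2 * c) ^ 7

-- Replacing the upper logarithm by the lower one costs a factor 2, so `suc (idLength c n)` is at
-- most (1 + 2c) l. As l ≥ 1, the exponent 7 may be raised to 11.
rounds-bound : ∀ c n → Schedule.horizon (idLength c n) ≤ roundConstant c * (1 ⊔ ⌊log₂ n ⌋) ^ 11
rounds-bound c n = begin
  Schedule.horizon (idLength c n)       ≤⟨ Schedule.horizon-bound (idLength c n) ⟩
  512 * suc (idLength c n) ^ 7          ≤⟨ *-monoʳ-≤ 512 (^-monoˡ-≤ 7 id-short) ⟩
  512 * ((1 + 2 * c) * l) ^ 7           ≡⟨ trans (cong (512 *_) (^-distribʳ-* (1 + 2 * c) l 7)) (sym (*-assoc 512 ((1 + 2 * c) ^ 7) (l ^ 7))) ⟩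
  512 * (1 + 2 * c) ^ 7 * l ^ 7         ≤⟨ *-monoʳ-≤ (512 * (1 + 2 * c) ^ 7) (^-monoʳ-≤ l {{l≢0}} (m≤m+n 7 4)) ⟩
  512 * (1 + 2 * c) ^ 7 * l ^ 11        ∎
  where
  open ≤-Reasoning
  l = 1 ⊔ ⌊log₂ n ⌋
  l≥1 : 1 ≤ l
  l≥1 = m≤m⊔n 1 ⌊log₂ n ⌋
  l≢0 = >-nonZero l≥1
  log-short : 1 ⊔ ⌈log₂ n ⌉ ≤ 2 * l
  log-short = ⊔-lub (≤-trans l≥1 (m≤m+n l _))
    (≤-trans (⌈log₂n⌉≤1+⌊log₂n⌋ n)
      (+-mono-≤ l≥1 (≤-trans (m≤n⊔m 1 ⌊log₂ n ⌋) (≤-reflexive (sym (+-identityʳ l))))))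
  id-short : suc (idLength c n) ≤ (1 + 2 * c) * l
  id-short = +-mono-≤ l≥1 (≤-trans (*-monoʳ-≤ c log-short)
    (≤-reflexive (regroup c l)))
    where
    regroup : ∀ c l → c * (2 * l) ≡ 2 * c * l
    regroup = ℕ-Solver.solve-∀

theorem3p1 : ∀ (c : ℕ) →
    Σ (LocalAlgorithm c) λ A →
    Σ ℕ λ C →
    ∀ (ε : ℝ) → 0ℚ <ᴿ ε → ε ᴿ< 1ℚ →
    ∀ (n : ℕ) (G : Graph n) (ident : Fin n → ID c n) → Injective _≡_ _≡_ ident →
    let P = A n (maxDegree G) ε in
    RoundBound n ε C (rounds P) ×
    (∃ λ k → (AtMost[2+ ε ]* maxDegree G) k ×
    IsProperEdgeColouring G k (colouring {c} {n} P G ident))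
theorem3p1 c =
  (λ n _ _ → greedyColouring (idLength c n)) , roundConstant c , λ ε 0<ε ε<1 n G ident ident-inj →
  round-bound n ε (roundConstant c) (Schedule.horizon (idLength c n)) ε<1 (rounds-bound c n) ,
  maxDegree G + maxDegree G , twice-at-most ε 0<ε (maxDegree G) ,
  Flooding.proper-colouring {c} G ident ident-inj
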